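{- Let $N$ be a finite set, let $(K,V)$ be a finite simplicial complex, and let $f:K\rightarrow PN$ be a subdivision of the simplex $PN=(PN,N)$, where $PN$ is the set of all subsets of $N$. Let $I$ be a finite nonempty set and let $\{c_i\}_{i\in I}$ be a family of Sperner colorings for the subdivision $f$. Then for every collection $\{m_i\}_{i\in I}$ of nonnegative integers with $\sum_{i\in I}m_i=|N|-1$ there is a face $\sigma\in K$ such that $|c_i(\sigma)|>m_i$ for every $i\in I$ and $\bigcup_{i\in I} c_i(\sigma)=N$.
   Context: A finite simplicial complex is a pair $(K,V)$ with $V$ a finite set of vertices and $K\subseteq PV=\{S\mid S\subseteq V\}$ a set of faces closed under inclusion: if $A\subseteq B\in K$ then $A\in K$. For a finite set $N$, $PN=(PN,N)$ denotes the full simplex on $N$, whose faces are all subsets of $N$. The geometric realization of $(K,V)$ is the subspace of $\mathbb{R}^V$ given by $$|K|=\Big\{k:V\rightarrow\mathbb{R}_{\geq 0}\ \Big|\ \sum_{v\in V}k(v)=1,\ k^{ -1}(\mathbb{R}_{>0})\in K\Big\}.$$ A map between finite simplicial complexes $(K,V)$ and $(K',V')$ is any order preserving map $f:K\rightarrow K'$, meaning that if $A\subseteq B\in K$ then $f(A)\subseteq f(B)\in K'$. The map $f$ is simplicial if it is induced by a vertex map $f_0:V\rightarrow V'$ in the sense that $f(A)=\{f_0(v)\mid v\in A\}$ for every $A\in K$. A map $f:K\rightarrow K'$ is a subdivision if there is a homeomorphism $h_f:|K|\rightarrow|K'|$ inducing $f$ in the sense that $(h_f(k))^{ -1}(\mathbb{R}_{>0})=f(k^{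 -1}(\mathbb{R}_{>0}))$ for every $k\in|K|$. For maps $f,f':K\rightarrow K'$ write $f\leq f'$, and call $f$ a specialization of $f'$, if $f(A)\subseteq f'(A)$ for every $A\in K$. A Sperner coloring for a subdivision $f$ is a simplicial map $c:K\rightarrow K'$ with $c\leq f$, i.e. a simplicial specialization of $f$. -}

module Defs where

open import Level using (0ℓ)
import Algebra.Properties.AbelianGroup as AbelianGroupProperties
import Algebra.Properties.Group as GroupProperties
open import Data.Nat.Base as ℕ using (ℕ)
import Data.Nat.Properties as ℕₚ
open import Data.Rational.Base
  using (ℚ; 0ℚ; 1ℚ; ½; _+_; _-_; _*_; -_; ∣_∣; _≤_; _<_)
import Data.Rational.Properties as ℚₚ
open import Data.Rational.Solver using (module +-*-Solver)
open import Data.Fin.Base using (Fin)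
open import Data.Fin.Subset using (Subset; _∈_; _⊆_)
open import Data.Product.Base using (Σ; ∃; _×_; _,_; proj₁)
open import Data.Sum.Base using (inj₁; inj₂)
open import Data.Unit.Base using (tt)
import Data.Vec.Functional as Vector
open import Function.Bundles using (_⇔_; Inverse)
open import Relation.Binary.Bundles using (Setoid)
open import Relation.Binary.PropositionalEquality
  using (_≡_; refl; sym; trans; cong; subst)
open import Relation.Nullary.Negation using (¬_)
open import Relation.Unary using (Pred; U)

-- Real numbers are Cauchy sequences of rationals; their equality is _≈_, not
-- _≡_.
IsCauchy : (ℕ → ℚ) → Set
IsCauchy s = ∀ ε → 0ℚ < ε → ∃ λ N → ∀ m n → N ℕ.≤ m → N ℕ.≤ n → ∣ s m - s n ∣ < ε

record ℝ : Set where
  constructor mkℝ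
  field
    seq      : ℕ → ℚ
    isCauchy : IsCauchy seq

open ℝ public

infix  4 _≈_ _<ℝ_ _≤ℝ_
infixl 6 _+ℝ_ _-ℝ_
infix  8 -ℝ_

record _≈_ (x y : ℝ) : Set where
  constructor mk≈
  field
    limit≡0 : ∀ ε → 0ℚ < ε → ∃ λ N → ∀ n → N ℕ.≤ n → ∣ seq x n - seq y n ∣ < ε

-- A termwise strict inequality of sequences would not respect _≈_, hence
-- the positive rational gap.
record _<ℝ_ (x y : ℝ) : Set where
  constructor mk<
  field
    gap   : ℚ
    index : ℕ
    0<gap : 0ℚ < gap
    apart : ∀ n → index ℕ.≤ n → seq x n + gap < seq y n

open _≈_ public

_≤ℝ_ : ℝ → ℝ → Set
x ≤ℝ y = ¬ (y <ℝ x)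

private
  open GroupProperties ℚₚ.+-0-group using (//-rightDividesˡ; //-rightDividesʳ)
  open AbelianGroupProperties ℚₚ.+-0-abelianGroup using (⁻¹-anti-homo‿-)

  0<½* : ∀ {ε} → 0ℚ < ε → 0ℚ < ½ * ε
  0<½* {ε} 0<ε =
    subst (_< ½ * ε) (ℚₚ.*-zeroʳ ½) (ℚₚ.*-monoʳ-<-pos ½ 0<ε)

  ½+½ : ∀ ε → ½ * ε + ½ * ε ≡ ε
  ½+½ ε = trans (sym (ℚₚ.*-distribʳ-+ ε ½ ½)) (ℚₚ.*-identityˡ ε)

  halves : ∀ a b {p} {ε} → a + b ≡ p →
           ∣ a ∣ < ½ * ε → ∣ b ∣ < ½ * ε → ∣ p ∣ < ε
  halves a b {p} {ε} eq a< b< =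
    subst (λ t → ∣ t ∣ < ε) eq
      (ℚₚ.≤-<-trans (ℚₚ.∣p+q∣≤∣p∣+∣q∣ a b)
        (subst (∣ a ∣ + ∣ b ∣ <_) (½+½ ε) (ℚₚ.+-mono-< a< b<)))

  ∣-∣-comm : ∀ p q → ∣ p - q ∣ ≡ ∣ q - p ∣
  ∣-∣-comm p q = trans (sym (ℚₚ.∣-p∣≡∣p∣ (p - q))) (cong ∣_∣ (⁻¹-anti-homo‿- p q))

  telescope : ∀ p q r → (p - q) + (q - r) ≡ p - r
  telescope p q r =
    trans (sym (ℚₚ.+-assoc (p - q) q (- r))) (cong (_- r) (//-rightDividesˡ q p))

  abs : ℚ → ℚ
  abs = ∣_∣

  abs-shift : ∀ p q → abs p - abs q ≤ abs (p - q)
  abs-shift p q =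
    subst (abs p - abs q ≤_) (//-rightDividesʳ (abs q) (abs (p - q)))
      (ℚₚ.+-monoˡ-≤ (- abs q)
        (subst (λ t → abs t ≤ abs (p - q) + abs q) (//-rightDividesˡ q p)
          (ℚₚ.∣p+q∣≤∣p∣+∣q∣ (p - q) q)))

  abs-lipschitz : ∀ p q → abs (abs p - abs q) ≤ abs (p - q)
  abs-lipschitz p q with ℚₚ.∣p∣≡p∨∣p∣≡-p (abs p - abs q)
  ... | inj₁ eq = subst (_≤ abs (p - q)) (sym eq) (abs-shift p q)
  ... | inj₂ eq =
    subst (_≤ abs (p - q)) (trans (sym (⁻¹-anti-homo‿- (abs p) (abs q))) (sym eq))
      (subst (abs q - abs p ≤_) (∣-∣-comm q p) (abs-shift q p))

0ℝ 1ℝ : ℝ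
0ℝ = mkℝ (λ _ → 0ℚ) (λ _ 0<ε → 0 , λ _ _ _ _ → 0<ε)
1ℝ = mkℝ (λ _ → 1ℚ) (λ _ 0<ε → 0 , λ _ _ _ _ → 0<ε)

abstract
  +-isCauchy : ∀ x y → IsCauchy (λ n → seq x n + seq y n)
  +-isCauchy x y ε 0<ε =
    let M , P = isCauchy x (½ * ε) (0<½* 0<ε)
        N , Q = isCauchy y (½ * ε) (0<½* 0<ε)
    in M ℕ.⊔ N , λ m n m≥ n≥ →
       halves (seq x m - seq x n) (seq y m - seq y n)
              (shuffle (seq x m) (seq x n) (seq y m) (seq y n))
              (P m n (ℕₚ.m⊔n≤o⇒m≤o M N m≥) (ℕₚ.m⊔n≤o⇒m≤o M N n≥))
              (Q m n (ℕₚ.m⊔n≤o⇒n≤o M N m≥) (ℕₚ.m⊔n≤o⇒n≤o M N n≥))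
    where
    open +-*-Solver
    shuffle : ∀ a b c d → (a - b) + (c - d) ≡ (a + c) - (b + d)
    shuffle = solve 4 (λ a b c d → (a :- b) :+ (c :- d) := (a :+ c) :- (b :+ d)) refl

  neg-isCauchy : ∀ x → IsCauchy (λ n → - seq x n)
  neg-isCauchy x ε 0<ε =
    let N , P = isCauchy x ε 0<ε
    in N , λ m n m≥ n≥ →
       subst (_< ε)
         (trans (∣-∣-comm (seq x m) (seq x n)) (cong ∣_∣ (swap (seq x m) (seq x n))))
         (P m n m≥ n≥)
    where
    open +-*-Solver
    swap : ∀ a b → b - a ≡ - a - - b
    swap = solve 2 (λ a b → b :- a := (:- a) :- (:- b)) refl

  abs-isCauchy : ∀ x → IsCauchy (λ n → ∣ seq x n ∣)
  abs-isCauchy x ε 0<ε =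
    let N , P = isCauchy x ε 0<ε
    in N , λ m n m≥ n≥ →
       ℚₚ.≤-<-trans (abs-lipschitz (seq x m) (seq x n)) (P m n m≥ n≥)

_+ℝ_ : ℝ → ℝ → ℝ
x +ℝ y = mkℝ (λ n → seq x n + seq y n) (+-isCauchy x y)

-ℝ_ : ℝ → ℝ
-ℝ x = mkℝ (λ n → - seq x n) (neg-isCauchy x)

_-ℝ_ : ℝ → ℝ → ℝ
x -ℝ y = x +ℝ (-ℝ y)

∣_∣ℝ : ℝ → ℝ
∣ x ∣ℝ = mkℝ (λ n → ∣ seq x n ∣) (abs-isCauchy x)

sumℝ : ∀ {n} → (Fin n → ℝ) → ℝ
sumℝ = Vector.foldr _+ℝ_ 0ℝ

≈-refl : ∀ {x} → x ≈ x
≈-refl {x} = mk≈ λ ε 0<ε →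
  0 , λ n _ → subst (λ t → ∣ t ∣ < ε) (sym (ℚₚ.+-inverseʳ (seq x n))) 0<ε

≈-sym : ∀ {x y} → x ≈ y → y ≈ x
≈-sym {x} {y} x≈y = mk≈ λ ε 0<ε →
  let N , P = limit≡0 x≈y ε 0<ε
  in N , λ n n≥ → subst (_< ε) (∣-∣-comm (seq x n) (seq y n)) (P n n≥)

≈-trans : ∀ {x y z} → x ≈ y → y ≈ z → x ≈ z
≈-trans {x} {y} {z} x≈y y≈z = mk≈ λ ε 0<ε →
  let M , P = limit≡0 x≈y (½ * ε) (0<½* 0<ε)
      N , Q = limit≡0 y≈z (½ * ε) (0<½* 0<ε)
  in M ℕ.⊔ N , λ n n≥ →
     halves (seq x n - seq y n) (seq y n - seq z n)
            (telescope (seq x n) (seq y n) (seq z n))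
            (P n (ℕₚ.m⊔n≤o⇒m≤o M N n≥))
            (Q n (ℕₚ.m⊔n≤o⇒n≤o M N n≥))

-- The vertex set is Fin v.  A vertex need not span a face, and K need not
-- contain the empty face.
record SimplicialComplex (v : ℕ) : Set₁ where
  field
    IsFace      : Pred (Subset v) 0ℓ
    down-closed : ∀ {A B} → A ⊆ B → IsFace B → IsFace A

open SimplicialComplex public

Face : ∀ {v} → SimplicialComplex v → Set
Face {v} K = Σ (Subset v) (IsFace K)

fullSimplex : ∀ n → SimplicialComplex n
fullSimplex n = record { IsFace = U ; down-closed = λ _ _ → tt }

-- By monotonicity and antisymmetry of _⊆_, the vertices of to A do not
-- depend on the proof that A is a face.
record SMap {v v′} (K : SimplicialComplex v) (K′ : SimplicialComplex v′) : Set where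
  field
    to   : Face K → Face K′
    mono : ∀ (A B : Face K) → proj₁ A ⊆ proj₁ B → proj₁ (to A) ⊆ proj₁ (to B)

  image : Face K → Subset v′
  image A = proj₁ (to A)

open SMap public using (image)

module _ {v v′} {K : SimplicialComplex v} {K′ : SimplicialComplex v′} where

  IsSimplicial : SMap K K′ → Set
  IsSimplicial f = ∃ λ (f₀ : Fin v → Fin v′) →
    ∀ (A : Face K) w → w ∈ image f A ⇔ (∃ λ u → u ∈ proj₁ A × w ≡ f₀ u)

  _≼_ : SMap K K′ → SMap K K′ → Set
  f ≼ f′ = ∀ (A : Face K) → image f A ⊆ image f′ A

-- Membership of the support k⁻¹(ℝ>0) in K is witnessed by a face whose
-- vertices are exactly the u with k u > 0; such a face is determined by k.
record ∥_∥ {v} (K : SimplicialComplex v) : Set where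
  field
    coord       : Fin v → ℝ
    nonneg      : ∀ u → 0ℝ ≤ℝ coord u
    sum≈1       : sumℝ coord ≈ 1ℝ
    support     : Face K
    support-def : ∀ u → u ∈ proj₁ support ⇔ 0ℝ <ℝ coord u

open ∥_∥ public

realization : ∀ {v} → SimplicialComplex v → Setoid 0ℓ 0ℓ
realization K = record
  { Carrier       = ∥ K ∥
  ; _≈_           = λ k l → ∀ u → coord k u ≈ coord l u
  ; isEquivalence = record
    { refl  = λ u → ≈-refl
    ; sym   = λ p u → ≈-sym (p u)
    ; trans = λ p q u → ≈-trans (p u) (q u)
    }
  }

-- ε–δ continuity for the maximum metrics, which induce the subspace
-- topologies of ℝ^V and ℝ^V′.
Continuous : ∀ {v v′} {K : SimplicialComplex v} {K′ : SimplicialComplex v′} →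
             (∥ K ∥ → ∥ K′ ∥) → Set
Continuous {K = K} h = ∀ (k : ∥ K ∥) ε → 0ℝ <ℝ ε → ∃ λ δ → 0ℝ <ℝ δ ×
  (∀ (l : ∥ K ∥) → (∀ u → ∣ coord k u -ℝ coord l u ∣ℝ <ℝ δ) →
                   (∀ w → ∣ coord (h k) w -ℝ coord (h l) w ∣ℝ <ℝ ε))

record Homeomorphism {v v′} (K : SimplicialComplex v) (K′ : SimplicialComplex v′) : Set where
  field
    bijection       : Inverse (realization K) (realization K′)
    to-continuous   : Continuous {K = K} {K′ = K′} (Inverse.to bijection)
    from-continuous : Continuous {K = K′} {K′ = K} (Inverse.from bijection)

  apply : ∥ K ∥ → ∥ K′ ∥
  apply = Inverse.to bijection

module _ {v v′} {K : SimplicialComplex v} {K′ : SimplicialComplex v′} where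

  IsSubdivision : SMap K K′ → Set
  IsSubdivision f = ∃ λ (h : Homeomorphism K K′) → ∀ (k : ∥ K ∥) →
    proj₁ (support (Homeomorphism.apply h k)) ≡ image f (support k)

  IsSpernerColoring : SMap K K′ → SMap K K′ → Set
  IsSpernerColoring f c = IsSimplicial c × c ≼ f

sumℕ : ∀ {l} → (Fin l → ℕ) → ℕ
sumℕ = Vector.foldr ℕ._+_ 0

module Submission where

-- Give the color class i the weight W i = m i * l + 1, so that the weights add
-- up to n * l, and let F j be the linear function on |K| adding, over all i and
-- all vertices u with c i u = j, the weight W i times the coordinate of u.  It
-- suffices to find a point of |K|, with support σ, at which all F j are equal,
-- hence equal to l.  Indeed, the vertices of σ have their color i in
-- S = c i (σ), so W i ≤ Σ_{j ∈ S} F j = ∣ S ∣ * l, that is m i < ∣ S ∣; and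
-- with S the union of the c i (σ) the same count, now of all the weights, gives
-- n * l ≤ ∣ S ∣ * l.  Since these are inequalities between integers, it is
-- enough that the F j are approximately equal.
--
-- Such a point comes from the Poincaré–Miranda theorem for a grid in the cube
-- [0,k]^(n-1), mapped to the simplex by breaking off sticks of length t i: when
-- t i = 0 the coordinate suc i vanishes, and when t i = k the coordinate zero
-- does.  As F ∘ h⁻¹ preserves the faces of the simplex, F (suc i) - F zero has
-- opposite signs on opposite sides of the cube, so in some small cell each of
-- these differences changes sign.  The cells for k → ∞ accumulate at a point,
-- and h⁻¹ is continuous there.

open import Defs
open import Algebra.Bundles using (CommutativeRing)
open import Axiom.ExcludedMiddle using (ExcludedMiddle)
open import Level using (0ℓ)
open import Data.Bool.Base using (Bool; true; false; _∧_; _xor_; if_then_else_)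
open import Data.Bool.Properties as 𝔹 using ()
import Data.Bool.Solver as 𝔹-Solver
open import Data.Empty using (⊥-elim)
open import Data.Fin.Base using (Fin; zero; suc)
import Data.Fin.Properties as Finₚ
open import Data.Fin.Subset using (Subset; _∈_; _∉_; ⋃; ⊤) renaming (∣_∣ to card)
open import Data.Fin.Subset.Properties using (_∈?_; ∣p∣≤n; ∣p∣≡n⇒p≡⊤; x∈p∪q⁺)
import Data.Integer.Base as ℤ
import Data.Integer.Properties as ℤₚ
open import Data.List.Base as List using (List; []; _∷_)
open import Data.List.Relation.Unary.All as All using (All; []; _∷_)
open import Data.Nat.Base as ℕ using (ℕ; zero; suc; _∸_)
open import Data.Nat.Coprimality as Coprime using (1-coprimeTo)
import Data.Nat.Properties as ℕₚ
open import Data.Product.Base using (∃; ∃₂; _×_; _,_; proj₁; proj₂)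
open import Data.Rational.Base
  using (ℚ; mkℚ; 0ℚ; 1ℚ; ½; _+_; _-_; _*_; -_; ∣_∣; _≤_; _<_; _⊔_; 1/_; Positive; positive; *<*)
import Data.Rational.Properties as ℚₚ
open import Data.Rational.Solver using (module +-*-Solver)
import Data.Rational.Unnormalised.Base as ℚᵘ
import Data.Rational.Unnormalised.Properties as ℚᵘₚ
open import Data.Sum.Base using (_⊎_; inj₁; inj₂)
open import Data.Vec.Base as Vec using (Vec; []; _∷_; lookup)
import Data.Vec.Properties as Vecₚ
open import Function.Base using (_∘_; id)
open import Function.Bundles using (_⇔_; mk⇔; Equivalence; Inverse)
open import Relation.Binary.PropositionalEquality
open import Relation.Nullary using (¬_; yes; no; does)
open import Relation.Nullary.Decidable using (dec-true)
open import Relation.Unary using (Decidable)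

import Algebra.Properties.Semiring.Sum ℕₚ.+-*-semiring as ℕ-Sum
open import Algebra.Properties.CommutativeMonoid.Mult ℚₚ.+-0-commutativeMonoid
  using (×-distrib-+)
open import Algebra.Properties.Semiring.Mult (CommutativeRing.semiring ℚₚ.+-*-commutativeRing)
  using (×-homo-+; ×-assocˡ; ×-assoc-*) renaming (_×_ to infixr 8 _·_)
open import Algebra.Properties.Semiring.Sum (CommutativeRing.semiring ℚₚ.+-*-commutativeRing)
  using (sum; sum-cong-≗; sum-replicate; ∑-distrib-+; ∑-comm)

-- Mod 2 cochains on ordered simplices

xor-interchange : ∀ a b c d → (a xor b) xor (c xor d) ≡ (a xor c) xor (b xor d)
xor-interchange = solve 4 (λ a b c d → (a :+ b) :+ (c :+ d) := (a :+ c) :+ (b :+ d)) refl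
  where open 𝔹-Solver.xor-∧-Solver

module _ {a} {A : Set a} where

  -- The simplicial coboundary mod 2: the sum of g over the lists with one entry deleted. The empty
  -- list counts as the face of a single vertex, as in the augmented complex.
  δ : (List A → Bool) → List A → Bool
  δ g []      = false
  δ g (v ∷ σ) = g σ xor δ (g ∘ (v ∷_)) σ

  δ-cong : ∀ {g h : List A → Bool} → g ≗ h → δ g ≗ δ h
  δ-cong eq []      = refl
  δ-cong eq (v ∷ σ) = cong₂ _xor_ (eq σ) (δ-cong (eq ∘ (v ∷_)) σ)

  δ-xor : ∀ (g h : List A → Bool) σ → δ (λ τ → g τ xor h τ) σ ≡ δ g σ xor δ h σ
  δ-xor g h []      = refl
  δ-xor g h (v ∷ σ) = trans (cong ((g σ xor h σ) xor_) (δ-xor (g ∘ (v ∷_)) (h ∘ (v ∷_)) σ))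
                            (xor-interchange (g σ) (h σ) (δ (g ∘ (v ∷_)) σ) (δ (h ∘ (v ∷_)) σ))

  δ-∧ : ∀ b (g : List A → Bool) σ → δ (λ τ → b ∧ g τ) σ ≡ b ∧ δ g σ
  δ-∧ b g []      = sym (𝔹.∧-zeroʳ b)
  δ-∧ b g (v ∷ σ) = trans (cong ((b ∧ g σ) xor_) (δ-∧ b (g ∘ (v ∷_)) σ))
                          (sym (𝔹.∧-distribˡ-xor b (g σ) (δ (g ∘ (v ∷_)) σ)))

  -- The cup product of the coboundaries of the 0-cochains φ i.
  cup : ∀ {d} → (Fin d → A → Bool) → List A → Bool
  cup {zero}  φ (_ ∷ [])    = true
  cup {zero}  φ _           = false
  cup {suc d} φ (u ∷ v ∷ σ) = (φ zero u xor φ zero v) ∧ cup (φ ∘ suc) (v ∷ σ)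
  cup {suc d} φ _           = false

  infixr 7 _⌣_

  _⌣_ : (A → Bool) → (List A → Bool) → List A → Bool
  (ψ ⌣ g) []      = false
  (ψ ⌣ g) (v ∷ σ) = ψ v ∧ g (v ∷ σ)

  cup-[] : ∀ {d} (φ : Fin d → A → Bool) → cup φ [] ≡ false
  cup-[] {zero}  φ = refl
  cup-[] {suc d} φ = refl

  -- Every factor is a coboundary, so by the Leibniz rule the product is a cocycle. In the induction
  -- the two terms with `G` merge because (φ v + φ w) + (φ u + φ w) = φ u + φ v mod 2.
  δ-cup : ∀ {d} (φ : Fin d → A → Bool) σ → δ (cup φ) σ ≡ false
  δ-cup φ []                     = refl
  δ-cup {zero} φ (_ ∷ [])        = refl
  δ-cup {zero} φ (_ ∷ _ ∷ [])    = refl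
  δ-cup {zero} φ (_ ∷ _ ∷ _ ∷ σ) = δ-0 σ
    where
    δ-0 : ∀ σ → δ (λ _ → false) σ ≡ false
    δ-0 []      = refl
    δ-0 (_ ∷ σ) = δ-0 σ
  δ-cup {suc d} φ (_ ∷ [])       = refl
  δ-cup {suc d} φ (u ∷ v ∷ [])   = refl
  δ-cup {suc d} φ (u ∷ v ∷ w ∷ σ) = begin
    (((p v xor p w) ∧ G) xor ((p u xor p w) ∧ G xor δ (λ τ → (p u xor p v) ∧ g (v ∷ τ)) (w ∷ σ)))
      ≡⟨ cong (λ t → ((p v xor p w) ∧ G) xor ((p u xor p w) ∧ G xor t)) (δ-∧ (p u xor p v) (g ∘ (v ∷_)) (w ∷ σ)) ⟩
    (((p v xor p w) ∧ G) xor ((p u xor p w) ∧ G xor (p u xor p v) ∧ D))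
      ≡⟨ lem (p u) (p v) (p w) G D ⟩
    (p u xor p v) ∧ (G xor D)
      ≡⟨ cong ((p u xor p v) ∧_) (δ-cup (φ ∘ suc) (v ∷ w ∷ σ)) ⟩
    (p u xor p v) ∧ false
      ≡⟨ 𝔹.∧-zeroʳ _ ⟩
    false ∎
    where
    open ≡-Reasoning
    p = φ zero
    g = cup (φ ∘ suc)
    G = g (w ∷ σ)
    D = δ (g ∘ (v ∷_)) (w ∷ σ)
    open 𝔹-Solver.xor-∧-Solver
    lem : ∀ a b c g h → ((b xor c) ∧ g) xor ((a xor c) ∧ g xor (a xor b) ∧ h) ≡ (a xor b) ∧ (g xor h)
    lem = solve 5 (λ a b c g h → ((b :+ c) :* g) :+ ((a :+ c) :* g :+ (a :+ b) :* h) := (a :+ b) :* (g :+ h)) refl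

  -- Leibniz rule: the other term contains the coboundary of `cup (φ ∘ suc)`, which vanishes by
  -- `δ-cup`. The primitive found here makes `stokes` applicable to `cup φ`.
  cup-suc : ∀ {d} (φ : Fin (suc d) → A → Bool) →
            cup φ ≗ δ (φ zero ⌣ cup (φ ∘ suc))
  cup-suc φ []          = refl
  cup-suc φ (u ∷ [])    = refl
  cup-suc φ (u ∷ v ∷ σ) = sym (begin
    (p v ∧ G) xor δ (λ τ → p u ∧ g (u ∷ τ)) (v ∷ σ)
      ≡⟨ cong ((p v ∧ G) xor_) (δ-∧ (p u) (g ∘ (u ∷_)) (v ∷ σ)) ⟩
    (p v ∧ G) xor (p u ∧ D)
      ≡⟨ lem (p u) (p v) G D ⟩
    ((p u xor p v) ∧ G) xor (p u ∧ (G xor D))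
      ≡⟨ cong (λ t → ((p u xor p v) ∧ G) xor (p u ∧ t)) (δ-cup (φ ∘ suc) (u ∷ v ∷ σ)) ⟩
    ((p u xor p v) ∧ G) xor (p u ∧ false)
      ≡⟨ cong (((p u xor p v) ∧ G) xor_) (𝔹.∧-zeroʳ (p u)) ⟩
    ((p u xor p v) ∧ G) xor false
      ≡⟨ 𝔹.xor-identityʳ _ ⟩
    (p u xor p v) ∧ G ∎)
    where
    open ≡-Reasoning
    p = φ zero
    g = cup (φ ∘ suc)
    G = g (v ∷ σ)
    D = δ (g ∘ (u ∷_)) (v ∷ σ)
    open 𝔹-Solver.xor-∧-Solver
    lem : ∀ a b g h → (b ∧ g) xor (a ∧ h) ≡ ((a xor b) ∧ g) xor (a ∧ (g xor h))
    lem = solve 4 (λ a b g h → (b :* g) :+ (a :* h) := ((a :+ b) :* g) :+ (a :* (g :+ h))) refl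

  cup-const : ∀ {d} (φ : Fin d → A → Bool) i b {σ} →
              All (λ v → φ i v ≡ b) σ → cup φ σ ≡ false
  cup-const φ zero    b []            = refl
  cup-const φ zero    b (_ ∷ [])      = refl
  cup-const φ zero    b (p ∷ q ∷ _)   =
    cong (_∧ _) (trans (cong₂ _xor_ p q) (𝔹.xor-same b))
  cup-const φ (suc i) b []            = refl
  cup-const φ (suc i) b (_ ∷ [])      = refl
  cup-const φ (suc i) b (p ∷ q ∷ r)   =
    trans (cong (_ ∧_) (cup-const (φ ∘ suc) i b (q ∷ r))) (𝔹.∧-zeroʳ _)

  -- A true product has only true factors, and factor i compares two consecutive entries. The
  -- predicate `P` records in which cell these entries lie.
  cup-crossing : ∀ {p} {P : A → Set p} {d} (φ : Fin d → A → Bool) {σ} →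
                 All P σ → cup φ σ ≡ true →
                 ∀ i → ∃₂ λ u v → (P u × φ i u ≡ false) × (P v × φ i v ≡ true)
  cup-crossing φ {u ∷ v ∷ _} (pu ∷ pv ∷ ps) eq zero
    with φ zero u in eu | φ zero v in ev | 𝔹.∧-conicalˡ (φ zero u xor φ zero v) _ eq
  ... | false | true | _ = _ , _ , (pu , eu) , (pv , ev)
  ... | true | false | _ = _ , _ , (pv , ev) , (pu , eu)
  cup-crossing {d = suc d} φ (pu ∷ pv ∷ ps) eq (suc i) =
    cup-crossing (φ ∘ suc) (pv ∷ ps) (𝔹.∧-conicalʳ _ _ eq) i

-- Pullbacks and the prism operator

module _ {α β} {A : Set α} {B : Set β} where

  δ-map : ∀ (t : A → B) (g : List B → Bool) σ →
          δ (g ∘ List.map t) σ ≡ δ g (List.map t σ)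
  δ-map t g []      = refl
  δ-map t g (v ∷ σ) = cong (g (List.map t σ) xor_) (δ-map t (g ∘ (t v ∷_)) σ)

  cup-map : ∀ {d} (t : A → B) (φ : Fin d → B → Bool) σ →
            cup φ (List.map t σ) ≡ cup (λ i → φ i ∘ t) σ
  cup-map {zero}  t φ []          = refl
  cup-map {zero}  t φ (_ ∷ [])    = refl
  cup-map {zero}  t φ (_ ∷ _ ∷ _) = refl
  cup-map {suc d} t φ []          = refl
  cup-map {suc d} t φ (_ ∷ [])    = refl
  cup-map {suc d} t φ (u ∷ v ∷ σ) = cong (_ ∧_) (cup-map t (φ ∘ suc) (v ∷ σ))

  -- The simplices a v₀, …, a vᵢ, b vᵢ, …, b vₘ triangulate the prism between
  -- the images of v₀, …, vₘ under a and b.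
  prism : (A → B) → (A → B) → (List B → Bool) → List A → Bool
  prism a b g []      = false
  prism a b g (v ∷ σ) = g (a v ∷ b v ∷ List.map b σ) xor prism a b (g ∘ (a v ∷_)) σ

  prism-cong : ∀ {a b : A → B} {g h : List B → Bool} → g ≗ h → prism a b g ≗ prism a b h
  prism-cong eq []      = refl
  prism-cong eq (v ∷ σ) = cong₂ _xor_ (eq _) (prism-cong (eq ∘ (_ ∷_)) σ)

  prism-xor : ∀ {a b : A → B} (g h : List B → Bool) σ →
              prism a b (λ τ → g τ xor h τ) σ ≡ prism a b g σ xor prism a b h σ
  prism-xor g h []      = refl
  prism-xor {a} {b} g h (v ∷ σ) =
    trans (cong ((g τ xor h τ) xor_) (prism-xor {a} {b} (g ∘ (a v ∷_)) (h ∘ (a v ∷_)) σ))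
          (xor-interchange (g τ) (h τ) (prism a b (g ∘ (a v ∷_)) σ) (prism a b (h ∘ (a v ∷_)) σ))
    where
    τ = a v ∷ b v ∷ List.map b σ

  -- The chain homotopy formula: mod 2, the boundary of a prism is its top, its bottom and the prism
  -- over the boundary of the base. The inner face counted by `X` belongs to the first simplex and
  -- to the rest of the prism, so it cancels.
  prism-δ : ∀ a b (g : List B → Bool) σ →
            prism a b (δ g) σ ≡
            (g (List.map b σ) xor g (List.map a σ)) xor δ (prism a b g) σ
  prism-δ a b g []      = lem (g [])
    where
    lem : ∀ x → false ≡ (x xor x) xor false
    lem x = sym (trans (𝔹.xor-identityʳ _) (𝔹.xor-same x))
  prism-δ a b g (v ∷ σ) = begin
    (g bσ xor (g (a v ∷ List.map b σ) xor δ gab (List.map b σ))) xor prism a b (δ g ∘ (a v ∷_)) σ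
      ≡⟨ cong ((g bσ xor (g (a v ∷ List.map b σ) xor δ gab (List.map b σ))) xor_) (prism-xor {a} {b} g (δ ga) σ) ⟩
    (g bσ xor (g (a v ∷ List.map b σ) xor δ gab (List.map b σ))) xor (P xor prism a b (δ ga) σ)
      ≡⟨ cong (λ t → (g bσ xor (g (a v ∷ List.map b σ) xor δ gab (List.map b σ))) xor (P xor t))
              (prism-δ a b ga σ) ⟩
    (g bσ xor (X xor δ gab (List.map b σ))) xor (P xor ((X xor g aσ) xor Q))
      ≡⟨ lem (g bσ) X (δ gab (List.map b σ)) P (g aσ) Q ⟩
    (g bσ xor g aσ) xor (P xor (δ gab (List.map b σ) xor Q))
      ≡⟨ cong (λ t → (g bσ xor g aσ) xor (P xor (t xor Q))) (δ-map b gab σ) ⟨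
    (g bσ xor g aσ) xor (P xor (δ (gab ∘ List.map b) σ xor Q))
      ≡⟨ cong (λ t → (g bσ xor g aσ) xor (P xor t)) (δ-xor (gab ∘ List.map b) (prism a b ga) σ) ⟨
    (g bσ xor g aσ) xor (P xor δ (prism a b g ∘ (v ∷_)) σ) ∎
    where
    open ≡-Reasoning
    bσ = List.map b (v ∷ σ)
    aσ = List.map a (v ∷ σ)
    ga gab : List B → Bool
    ga = g ∘ (a v ∷_)
    gab = ga ∘ (b v ∷_)
    X = g (a v ∷ List.map b σ)
    P = prism a b g σ
    Q = δ (prism a b ga) σ
    open 𝔹-Solver.xor-∧-Solver
    lem : ∀ x y z p w q → (x xor (y xor z)) xor (p xor ((y xor w) xor q)) ≡
                          (x xor w) xor (p xor (z xor q))
    lem = solve 6 (λ x y z p w q → (x :+ (y :+ z)) :+ (p :+ ((y :+ w) :+ q)) :=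
                                   (x :+ w) :+ (p :+ (z :+ q))) refl

  prism-support : ∀ {q} {Q : B → Set q} {a b : A → B} (g : List B → Bool) {σ} →
                  All (λ v → Q (a v) × Q (b v)) σ → prism a b g σ ≡ true →
                  ∃ λ τ → All Q τ × g τ ≡ true
  prism-support {Q = Q} {a} {b} g {v ∷ σ} ((qa , qb) ∷ qs) eq
    with g (a v ∷ b v ∷ List.map b σ) in e
  ... | true  = _ , qa ∷ qb ∷ map-b qs , e
    where
    map-b : ∀ {σ} → All (λ v → Q (a v) × Q (b v)) σ → All Q (List.map b σ)
    map-b []             = []
    map-b ((_ , q) ∷ qs) = q ∷ map-b qs
  ... | false with prism-support (g ∘ (a v ∷_)) qs eq
  ...   | τ , all , eq′ = a v ∷ τ , qa ∷ all , eq′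

-- The Freudenthal triangulation of the cube [0,k]ᵈ

module _ (k : ℕ) where

  ⨁ : ℕ → (ℕ → Bool) → Bool
  ⨁ zero    s = false
  ⨁ (suc t) s = s t xor ⨁ t s

  ⨁-cong : ∀ n {s s′ : ℕ → Bool} → s ≗ s′ → ⨁ n s ≡ ⨁ n s′
  ⨁-cong zero    eq = refl
  ⨁-cong (suc n) eq = cong₂ _xor_ (eq n) (⨁-cong n eq)

  ⨁-true : ∀ n (s : ℕ → Bool) → ⨁ n s ≡ true → ∃ λ t → s t ≡ true
  ⨁-true (suc n) s eq with s n in e
  ... | true  = n , e
  ... | false = ⨁-true n s eq

  -- The value of g on the sum of the top-dimensional simplices.
  ∫ : ∀ {d} → (List (Vec ℕ d) → Bool) → Bool
  ∫ {zero}  g = g ([] ∷ [])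
  ∫ {suc d} g = ⨁ k λ t → ∫ (prism (t ∷_) (suc t ∷_) g)

  ∫-cong : ∀ {d} {g h : List (Vec ℕ d) → Bool} → g ≗ h → ∫ g ≡ ∫ h
  ∫-cong {zero}  eq = eq _
  ∫-cong {suc d} eq = ⨁-cong k λ t → ∫-cong {d} (prism-cong {a = t ∷_} {b = suc t ∷_} eq)

  ∫-xor : ∀ {d} (g h : List (Vec ℕ d) → Bool) → ∫ (λ σ → g σ xor h σ) ≡ ∫ g xor ∫ h
  ∫-xor {zero}  g h = refl
  ∫-xor {suc d} g h =
    trans (⨁-cong k λ t → trans (∫-cong {d} (prism-xor {a = t ∷_} {b = suc t ∷_} g h)) (∫-xor {d} _ _)) (⨁-xor k _ _)
    where
    ⨁-xor : ∀ n (s s′ : ℕ → Bool) → ⨁ n (λ t → s t xor s′ t) ≡ ⨁ n s xor ⨁ n s′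
    ⨁-xor zero    s s′ = refl
    ⨁-xor (suc n) s s′ = trans (cong ((s n xor s′ n) xor_) (⨁-xor n s s′)) (xor-interchange (s n) (s′ n) _ _)

  Near : ∀ {d} → Vec ℕ d → Vec ℕ d → Set
  Near p v = ∀ i → lookup p i ℕ.≤ lookup v i × lookup v i ℕ.≤ suc (lookup p i)

  ∫-support : ∀ {d} (g : List (Vec ℕ d) → Bool) → ∫ g ≡ true →
              ∃₂ λ p σ → All (Near p) σ × g σ ≡ true
  ∫-support {zero}  g eq = [] , [] ∷ [] , (λ ()) ∷ [] , eq
  ∫-support {suc d} g eq with ⨁-true k _ eq
  ... | t , eq₁ with ∫-support (prism (t ∷_) (suc t ∷_) g) eq₁
  ...   | p , σ , near , eq₂
      with prism-support {Q = Near (t ∷ p)} g (All.map extend near) eq₂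
    where
    extend : ∀ {v} → Near p v → Near (t ∷ p) (t ∷ v) × Near (t ∷ p) (suc t ∷ v)
    extend {v} n = (λ { zero → ℕₚ.≤-refl , ℕₚ.n≤1+n t ; (suc i) → n i })
                 , (λ { zero → ℕₚ.n≤1+n t , ℕₚ.≤-refl ; (suc i) → n i })
  ...     | τ , near′ , eq₃ = t ∷ p , τ , near′ , eq₃

  ∫-false : ∀ {d} {g : List (Vec ℕ d) → Bool} → (∀ σ → g σ ≡ false) → ∫ g ≡ false
  ∫-false {g = g} all with ∫ g in eq
  ... | false = refl
  ... | true with ∫-support g eq
  ...   | _ , σ , _ , e = trans (sym e) (all σ)

  OnFace : ∀ {d} → Fin d → ℕ → List (Vec ℕ d) → Set
  OnFace i x = All λ v → lookup v i ≡ x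

  -- The condition on [] is for dimension 0, where there are no faces.
  VanishesOnBoundary : ∀ {d} → (List (Vec ℕ d) → Bool) → Set
  VanishesOnBoundary g = g [] ≡ false ×
    (∀ i x σ → x ≡ 0 ⊎ x ≡ k → OnFace i x σ → g σ ≡ false)

  -- The prism formula summed over the layers of the cube telescopes, leaving the two end faces. The
  -- side faces remain as integrals of coboundaries in one dimension less.
  stokes : ∀ {d} (g : List (Vec ℕ (suc d)) → Bool) →
           ∫ (δ g) ≡ (∫ (g ∘ List.map (k ∷_)) xor ∫ (g ∘ List.map (0 ∷_)))
                     xor ⨁ k λ t → ∫ (δ (prism (t ∷_) (suc t ∷_) g))
  stokes {d} g = go k
    where
    S : ℕ → Bool
    S t = ∫ (g ∘ List.map (t ∷_))
    R : ℕ → Bool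
    R t = ∫ (δ (prism (t ∷_) (suc t ∷_) g))
    open 𝔹-Solver.xor-∧-Solver
    lem : ∀ a b c d e → ((a xor b) xor c) xor ((b xor d) xor e) ≡ (a xor d) xor (c xor e)
    lem = solve 5 (λ a b c d e → ((a :+ b) :+ c) :+ ((b :+ d) :+ e) := (a :+ d) :+ (c :+ e)) refl
    go : ∀ n → ⨁ n (λ t → ∫ (prism (t ∷_) (suc t ∷_) (δ g))) ≡ (S n xor S 0) xor ⨁ n R
    go zero    = sym (trans (𝔹.xor-identityʳ _) (𝔹.xor-same (S 0)))
    go (suc n) = trans
      (cong₂ _xor_
        (trans (∫-cong {d} (prism-δ (n ∷_) (suc n ∷_) g))
               (trans (∫-xor {d} _ _) (cong (_xor R n) (∫-xor {d} _ _))))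
        (go n))
      (lem (S (suc n)) (S n) (R n) (S 0) (⨁ n R))

  prism-vanishes : ∀ {d} {g : List (Vec ℕ (suc d)) → Bool} t →
                   (∀ i x σ → x ≡ 0 ⊎ x ≡ k → OnFace (suc i) x σ → g σ ≡ false) →
                   VanishesOnBoundary (prism (t ∷_) (suc t ∷_) g)
  prism-vanishes {g = g} t van = refl , λ i x σ x∈ on → case i x σ x∈ on
    where
    case : ∀ i x σ → x ≡ 0 ⊎ x ≡ k → OnFace i x σ → prism (t ∷_) (suc t ∷_) g σ ≡ false
    case i x σ x∈ on with prism (t ∷_) (suc t ∷_) g σ in eq
    ... | false = refl
    ... | true with prism-support {Q = λ v → lookup v (suc i) ≡ x} g (All.map (λ e → e , e) on) eq
    ...   | τ , on′ , e = trans (sym e) (van i x τ x∈ on′)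

  -- Induction on d by `stokes`: the end faces contribute nothing, and the prism cochain of each
  -- layer vanishes on the boundary of the smaller cube.
  ∫-δ : ∀ {d} {g : List (Vec ℕ d) → Bool} → VanishesOnBoundary g → ∫ (δ g) ≡ false
  ∫-δ {zero}  {g} (g[] , _) = trans (𝔹.xor-identityʳ (g [])) g[]
  ∫-δ {suc d} {g} (g[] , van) =
    trans (stokes g)
      (cong₂ _xor_ (cong₂ _xor_ (∫-false {d} λ σ → van zero k _ (inj₂ refl) (face k σ))
                                (∫-false {d} λ σ → van zero 0 _ (inj₁ refl) (face 0 σ)))
                   (⨁-false k λ t → ∫-δ {d} (prism-vanishes t (van ∘ suc))))
    where
    face : ∀ x σ → OnFace zero x (List.map (x ∷_) σ)
    face x []      = []
    face x (_ ∷ σ) = refl ∷ face x σ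
    ⨁-false : ∀ n {s : ℕ → Bool} → (∀ t → s t ≡ false) → ⨁ n s ≡ false
    ⨁-false zero    eq = refl
    ⨁-false (suc n) eq = cong₂ _xor_ (eq n) (⨁-false n eq)

  -- Induction on d by `stokes` for the primitive `g`. On the top face `φ zero` is true and `g`
  -- restricts to the cup product of one dimension less; on the bottom face `φ zero` is false; on a
  -- side face some later `φ i` is constant, so `g` vanishes there.
  ∫-cup : ∀ {d} (φ : Fin d → Vec ℕ d → Bool) →
          (∀ i v → lookup v i ≡ 0 → φ i v ≡ false) →
          (∀ i v → lookup v i ≡ k → φ i v ≡ true) →
          ∫ (cup φ) ≡ true
  ∫-cup {zero}  φ low high = refl
  ∫-cup {suc d} φ low high = begin
    ∫ (cup φ)    ≡⟨ ∫-cong (cup-suc φ) ⟩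
    ∫ (δ g)      ≡⟨ stokes g ⟩
    (∫ (g ∘ List.map (k ∷_)) xor ∫ (g ∘ List.map (0 ∷_))) xor
      ⨁ k (λ t → ∫ (δ (prism (t ∷_) (suc t ∷_) g)))
      ≡⟨ cong₂ _xor_ (cong₂ _xor_ top bottom) sides ⟩
    true ∎
    where
    open ≡-Reasoning
    g : List (Vec ℕ (suc d)) → Bool
    g = φ zero ⌣ cup (φ ∘ suc)
    top : ∫ (g ∘ List.map (k ∷_)) ≡ true
    top = trans (∫-cong {d} λ where
        []      → sym (cup-[] {d = d} (λ i v → φ (suc i) (k ∷ v)))
        (v ∷ σ) → trans (cong (_∧ cup (φ ∘ suc) (List.map (k ∷_) (v ∷ σ))) (high zero (k ∷ v) refl))
                        (cup-map (k ∷_) (φ ∘ suc) (v ∷ σ)))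
      (∫-cup (λ i v → φ (suc i) (k ∷ v))
        (λ i v → low (suc i) (k ∷ v)) (λ i v → high (suc i) (k ∷ v)))
    bottom : ∫ (g ∘ List.map (0 ∷_)) ≡ false
    bottom = ∫-false {d} λ where
      []      → refl
      (v ∷ σ) → cong (_∧ cup (φ ∘ suc) (List.map (0 ∷_) (v ∷ σ))) (low zero (0 ∷ v) refl)
    vanish : ∀ i x σ → x ≡ 0 ⊎ x ≡ k → OnFace (suc i) x σ → g σ ≡ false
    vanish i x []      x∈ on = refl
    vanish i x (v ∷ σ) (inj₁ refl) on =
      trans (cong (φ zero v ∧_) (cup-const (φ ∘ suc) i false (All.map (low (suc i) _) on))) (𝔹.∧-zeroʳ _)
    vanish i x (v ∷ σ) (inj₂ refl) on =
      trans (cong (φ zero v ∧_) (cup-const (φ ∘ suc) i true (All.map (high (suc i) _) on))) (𝔹.∧-zeroʳ _)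
    sides : ⨁ k (λ t → ∫ (δ (prism (t ∷_) (suc t ∷_) g))) ≡ false
    sides with ⨁ k (λ t → ∫ (δ (prism (t ∷_) (suc t ∷_) g))) in eq
    ... | false = refl
    ... | true with ⨁-true k _ eq
    ...   | t , e = trans (sym e) (∫-δ {d} (prism-vanishes t vanish))

  -- The combinatorial Poincaré-Miranda theorem: an integral equal to `true` has a simplex where the
  -- cup product is true, and that simplex lies in the unit cube with lowest corner `p`.
  crossing-cell : ∀ {d} (φ : Fin d → Vec ℕ d → Bool) →
    (∀ i v → lookup v i ≡ 0 → φ i v ≡ false) →
    (∀ i v → lookup v i ≡ k → φ i v ≡ true) →
    ∃ λ p → ∀ i → ∃₂ λ u v → (Near p u × φ i u ≡ false) × (Near p v × φ i v ≡ true)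
  crossing-cell φ low high with ∫-support (cup φ) (∫-cup φ low high)
  ... | p , σ , near , eq = p , cup-crossing φ near eq

-- Rational sums and multiples

sum-mono : ∀ {n} {f g : Fin n → ℚ} → (∀ i → f i ≤ g i) → sum f ≤ sum g
sum-mono {zero}  f≤g = ℚₚ.≤-refl
sum-mono {suc n} f≤g = ℚₚ.+-mono-≤ (f≤g zero) (sum-mono (f≤g ∘ suc))

·-monoʳ-≤ : ∀ m {x y} → x ≤ y → m · x ≤ m · y
·-monoʳ-≤ zero    x≤y = ℚₚ.≤-refl
·-monoʳ-≤ (suc m) x≤y = ℚₚ.+-mono-≤ x≤y (·-monoʳ-≤ m x≤y)

·-monoʳ-< : ∀ m {x y} → x < y → suc m · x < suc m · y
·-monoʳ-< m x<y = ℚₚ.+-mono-<-≤ x<y (·-monoʳ-≤ m (ℚₚ.<⇒≤ x<y))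

·-cancelˡ-≤ : ∀ m {x y} → suc m · x ≤ suc m · y → x ≤ y
·-cancelˡ-≤ m le = ℚₚ.≮⇒≥ λ y<x → ℚₚ.<-irrefl refl (ℚₚ.<-≤-trans (·-monoʳ-< m y<x) le)

·-zeroʳ : ∀ m → m · 0ℚ ≡ 0ℚ
·-zeroʳ zero    = refl
·-zeroʳ (suc m) = trans (ℚₚ.+-identityˡ _) (·-zeroʳ m)

·-nonneg : ∀ m {x} → 0ℚ ≤ x → 0ℚ ≤ m · x
·-nonneg m 0≤x = subst (_≤ m · _) (·-zeroʳ m) (·-monoʳ-≤ m 0≤x)

p≤p+q : ∀ p {q} → 0ℚ ≤ q → p ≤ p + q
p≤p+q p 0≤q = subst (_≤ p + _) (ℚₚ.+-identityʳ p) (ℚₚ.+-monoʳ-≤ p 0≤q)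

·-monoˡ-≤ : ∀ {m n x} → 0ℚ ≤ x → m ℕ.≤ n → m · x ≤ n · x
·-monoˡ-≤ {n = n} 0≤x ℕ.z≤n = ·-nonneg n 0≤x
·-monoˡ-≤ {x = x} 0≤x (ℕ.s≤s m≤n) = ℚₚ.+-monoʳ-≤ x (·-monoˡ-≤ 0≤x m≤n)

sum-· : ∀ {n} (w : Fin n → ℕ) x → sum (λ i → w i · x) ≡ sumℕ w · x
sum-· {zero}  w x = refl
sum-· {suc n} w x =
  trans (cong (w zero · x +_) (sum-· (w ∘ suc) x)) (sym (×-homo-+ x (w zero) (sumℕ (w ∘ suc))))

-- Unit fractions and the Archimedean property

fromℕ≡ : ∀ m → m · 1ℚ ≡ mkℚ (ℤ.+ m) 0 (Coprime.sym (1-coprimeTo m))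
fromℕ≡ zero    = refl
fromℕ≡ (suc m) = trans (cong (1ℚ +_) (fromℕ≡ m))
  (trans (ℚₚ./-cong (cong (ℤ._+_ (ℤ.+ 1)) (ℤₚ.*-identityʳ (ℤ.+ m))) refl)
         (ℚₚ.normalize-coprime (Coprime.sym (1-coprimeTo (suc m)))))

suc·1-positive : ∀ m → Positive (suc m · 1ℚ)
suc·1-positive m = positive (ℚₚ.<-≤-trans (*<* (ℤ.+<+ (ℕ.s≤s ℕ.z≤n))) (p≤p+q 1ℚ (·-nonneg m (ℚₚ.nonNegative⁻¹ 1ℚ))))

unit : ℕ → ℚ
unit m = (1/ (suc m · 1ℚ)) {{ℚₚ.pos⇒nonZero (suc m · 1ℚ) {{suc·1-positive m}}}}

unit-positive : ∀ m → 0ℚ < unit m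
unit-positive m = ℚₚ.positive⁻¹ (unit m) {{ℚₚ.1/pos⇒pos (suc m · 1ℚ) {{suc·1-positive m}}}}

suc·unit : ∀ m → suc m · unit m ≡ 1ℚ
suc·unit m = begin
  suc m · unit m          ≡⟨ cong (suc m ·_) (ℚₚ.*-identityˡ (unit m)) ⟨
  suc m · (1ℚ * unit m)   ≡⟨ ×-assoc-* (suc m) 1ℚ (unit m) ⟨
  (suc m · 1ℚ) * unit m   ≡⟨ ℚₚ.*-inverseʳ (suc m · 1ℚ) {{ℚₚ.pos⇒nonZero (suc m · 1ℚ) {{suc·1-positive m}}}} ⟩
  1ℚ                      ∎
  where open ≡-Reasoning

archimedean : ∀ {ε} → 0ℚ < ε → ∃ λ m → 1ℚ ≤ suc m · ε
archimedean {mkℚ (ℤ.+ zero) _ _} (*<* (ℤ.+<+ ()))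
-- Here ε = (a + 1)/(b + 1), so b + 1 copies of it add up to a + 1.
archimedean {ε@(mkℚ (ℤ.+ suc a) b _)} _ = b , subst (1ℚ ≤_) eq le
  where
  N = mkℚ (ℤ.+ suc b) 0 (Coprime.sym (1-coprimeTo (suc b)))
  eq : N * ε ≡ suc b · ε
  eq = trans (cong (_* ε) (sym (fromℕ≡ (suc b))))
             (trans (×-assoc-* (suc b) 1ℚ ε) (cong (suc b ·_) (ℚₚ.*-identityˡ ε)))
  le : 1ℚ ≤ N * ε
  le = ℚₚ.toℚᵘ-cancel-≤ (ℚᵘₚ.≤-respʳ-≃ (ℚᵘₚ.≃-sym (ℚₚ.toℚᵘ-homo-* N ε))
    (ℚᵘ.*≤* (ℤ.+≤+ lem)))
    where
    open ℕₚ.≤-Reasoning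
    lem : 1 ℕ.* (1 ℕ.* suc b) ℕ.≤ (suc b ℕ.* suc a) ℕ.* 1
    lem = begin
      1 ℕ.* (1 ℕ.* suc b)    ≡⟨ trans (ℕₚ.*-identityˡ _) (ℕₚ.*-identityˡ _) ⟩
      suc b                  ≤⟨ ℕₚ.m≤m*n (suc b) (suc a) ⟩
      suc b ℕ.* suc a        ≡⟨ ℕₚ.*-identityʳ _ ⟨
      (suc b ℕ.* suc a) ℕ.* 1 ∎

unit-vanishes : ∀ {ε} → 0ℚ < ε → ∃ λ M → ∀ m → M ℕ.≤ m → unit m ≤ ε
unit-vanishes {ε} 0<ε with archimedean 0<ε
... | M , 1≤ = M , λ m M≤m → ·-cancelˡ-≤ m (subst (_≤ suc m · ε) (sym (suc·unit m))
  (ℚₚ.≤-trans 1≤ (·-monoˡ-≤ (ℚₚ.<⇒≤ 0<ε) (ℕ.s≤s M≤m))))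

module _ {p q} (0<p : 0ℚ < p) (0<q : 0ℚ < q) where

  *-positive : 0ℚ < p * q
  *-positive = ℚₚ.positive⁻¹ _ {{ℚₚ.pos*pos⇒pos p {{positive 0<p}} q {{positive 0<q}}}}

fraction : ∀ M {η} → 0ℚ < η → ∃ λ ε → 0ℚ < ε × M · ε ≤ η
-- Dividing by M + 1 rather than by M also covers M = 0.
fraction M {η} 0<η = unit M * η , *-positive (unit-positive M) 0<η , (begin
  M · (unit M * η)      ≤⟨ ·-monoˡ-≤ (ℚₚ.<⇒≤ (*-positive (unit-positive M) 0<η)) (ℕₚ.n≤1+n M) ⟩
  suc M · (unit M * η)  ≡⟨ ×-assoc-* (suc M) (unit M) η ⟨
  (suc M · unit M) * η  ≡⟨ cong (_* η) (suc·unit M) ⟩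
  1ℚ * η                ≡⟨ ℚₚ.*-identityˡ η ⟩
  η                     ∎)
  where open ℚₚ.≤-Reasoning

module _ {e η} (0<e : 0ℚ < e) (4e≤η : 4 · e ≤ η) where

  4e≤η⇒2e≤η : e + e ≤ η
  4e≤η⇒2e≤η = ℚₚ.≤-trans (subst (_≤ 4 · e) (cong (e +_) (ℚₚ.+-identityʳ e))
    (·-monoˡ-≤ {2} {4} (ℚₚ.<⇒≤ 0<e) (ℕₚ.m≤m+n 2 2))) 4e≤η

  4e≤η⇒3e≤η : e + e + e ≤ η
  4e≤η⇒3e≤η = ℚₚ.≤-trans (subst (_≤ 4 · e)
      (trans (cong (λ z → e + (e + z)) (ℚₚ.+-identityʳ e)) (sym (ℚₚ.+-assoc e e e)))
      (·-monoˡ-≤ {3} {4} (ℚₚ.<⇒≤ 0<e) (ℕₚ.n≤1+n 3)))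
    4e≤η

-- Bounds up to an error

≤+-trans : ∀ {p q r x y} → p ≤ q + x → q ≤ r + y → p ≤ r + (y + x)
≤+-trans {p} {q} {r} {x} {y} p≤ q≤ = begin
  p           ≤⟨ p≤ ⟩
  q + x       ≤⟨ ℚₚ.+-monoˡ-≤ x q≤ ⟩
  r + y + x   ≡⟨ ℚₚ.+-assoc r y x ⟩
  r + (y + x) ∎
  where open ℚₚ.≤-Reasoning

≤+-weaken : ∀ {p q x y} → x ≤ y → p ≤ q + x → p ≤ q + y
≤+-weaken {q = q} x≤y p≤ = ℚₚ.≤-trans p≤ (ℚₚ.+-monoʳ-≤ q x≤y)

-- Two one-sided bounds instead of an absolute value, so that errors accumulate by `≤+-trans`.
Within : ℚ → ℚ → ℚ → Set
Within ε p q = p ≤ q + ε × q ≤ p + ε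

p≤∣p∣ : ∀ p → p ≤ ∣ p ∣
p≤∣p∣ p with ℚₚ.≤-total 0ℚ p
... | inj₁ 0≤p = ℚₚ.≤-reflexive (sym (ℚₚ.0≤p⇒∣p∣≡p 0≤p))
... | inj₂ p≤0 = ℚₚ.≤-trans p≤0 (ℚₚ.0≤∣p∣ p)

private
  q+[p-q] : ∀ p q → q + (p - q) ≡ p
  q+[p-q] = solve 2 (λ p q → q :+ (p :- q) := p) refl
    where open +-*-Solver
  p-[p-q] : ∀ p q → p + - (p - q) ≡ q
  p-[p-q] = solve 2 (λ p q → p :+ (:- (p :- q)) := q) refl
    where open +-*-Solver
  [q+x]-q : ∀ q x → (q + x) - q ≡ x
  [q+x]-q = solve 2 (λ q x → (q :+ x) :- q := x) refl
    where open +-*-Solver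
  -[p-q] : ∀ p q → - (p - q) ≡ q - p
  -[p-q] = solve 2 (λ p q → :- (p :- q) := q :- p) refl
    where open +-*-Solver

∣-∣≤⇒within : ∀ {p q ε} → ∣ p - q ∣ ≤ ε → Within ε p q
∣-∣≤⇒within {p} {q} {ε} le =
  subst (_≤ q + ε) (q+[p-q] p q) (ℚₚ.+-monoʳ-≤ q (ℚₚ.≤-trans (p≤∣p∣ (p - q)) le)) ,
  subst (_≤ p + ε) (p-[p-q] p q) (ℚₚ.+-monoʳ-≤ p (ℚₚ.≤-trans
    (subst (- (p - q) ≤_) (ℚₚ.∣-p∣≡∣p∣ (p - q)) (p≤∣p∣ (- (p - q)))) le))

p≤q+x⇒p-q≤x : ∀ {p q x} → p ≤ q + x → p - q ≤ x
p≤q+x⇒p-q≤x {p} {q} {x} le = subst (p - q ≤_) ([q+x]-q q x) (ℚₚ.+-monoˡ-≤ (- q) le)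

within⇒∣-∣≤ : ∀ {p q ε} → Within ε p q → ∣ p - q ∣ ≤ ε
within⇒∣-∣≤ {p} {q} {ε} (p≤ , q≤) with ℚₚ.∣p∣≡p∨∣p∣≡-p (p - q)
... | inj₁ eq = subst (_≤ ε) (sym eq) (p≤q+x⇒p-q≤x p≤)
... | inj₂ eq = subst (_≤ ε) (sym (trans eq (-[p-q] p q))) (p≤q+x⇒p-q≤x q≤)

-- Sequences

Eventually : (ℕ → Set) → Set
Eventually P = ∃ λ N → ∀ n → N ℕ.≤ n → P n

always : ∀ {P : ℕ → Set} → (∀ n → P n) → Eventually P
always p = 0 , λ n _ → p n

ev-map : ∀ {P Q : ℕ → Set} → (∀ {n} → P n → Q n) → Eventually P → Eventually Q
ev-map f (N , p) = N , λ n N≤n → f (p n N≤n)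

ev-× : ∀ {P Q : ℕ → Set} → Eventually P → Eventually Q → Eventually (λ n → P n × Q n)
ev-× (M , p) (N , q) = M ℕ.⊔ N , λ n le →
  p n (ℕₚ.m⊔n≤o⇒m≤o M N le) , q n (ℕₚ.m⊔n≤o⇒n≤o M N le)

ev-zip : ∀ {P Q R : ℕ → Set} → (∀ {n} → P n → Q n → R n) →
         Eventually P → Eventually Q → Eventually R
ev-zip f p q = ev-map (λ (p , q) → f p q) (ev-× p q)

ev-∀ : ∀ {m} {P : Fin m → ℕ → Set} → (∀ i → Eventually (P i)) → Eventually (λ n → ∀ i → P i n)
ev-∀ {zero}  p = always λ _ ()
ev-∀ {suc m} p = ev-zip (λ p q → λ { zero → p ; (suc i) → q i }) (p zero) (ev-∀ (p ∘ suc))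

Cauchy : (ℕ → ℚ) → Set
Cauchy x = ∀ {ε} → 0ℚ < ε → ∃ λ N → ∀ m n → N ℕ.≤ m → N ℕ.≤ n → Within ε (x m) (x n)

cauchy-reindex : ∀ {x φ} → (∀ n → n ℕ.≤ φ n) → Cauchy x → Cauchy (x ∘ φ)
cauchy-reindex n≤φ c 0<ε with c 0<ε
... | N , p = N , λ m n N≤m N≤n →
  p _ _ (ℕₚ.≤-trans N≤m (n≤φ m)) (ℕₚ.≤-trans N≤n (n≤φ n))

width : ℕ → ℚ
width zero    = 1ℚ
width (suc m) = ½ * width m

½+½ : ∀ x → ½ * x + ½ * x ≡ x
½+½ x = trans (sym (ℚₚ.*-distribʳ-+ x ½ ½)) (ℚₚ.*-identityˡ x)

width-nonneg : ∀ m → 0ℚ ≤ width m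
width-nonneg zero    = ℚₚ.nonNegative⁻¹ 1ℚ
width-nonneg (suc m) = subst (_≤ ½ * width m) (ℚₚ.*-zeroʳ ½) (ℚₚ.*-monoˡ-≤-nonNeg ½ (width-nonneg m))

-- Induction shows (m + 1)/2^m ≤ 1, using m + 2 ≤ 2(m + 1). Thus `width` tends to zero because
-- `unit` does.
width≤unit : ∀ m → width m ≤ unit m
width≤unit m = ·-cancelˡ-≤ m (subst (suc m · width m ≤_) (sym (suc·unit m)) (suc·width≤1 m))
  where
  open ℚₚ.≤-Reasoning
  suc·width≤1 : ∀ m → suc m · width m ≤ 1ℚ
  suc·width≤1 zero    = ℚₚ.≤-refl
  suc·width≤1 (suc m) = begin
    suc (suc m) · h                   ≤⟨ ·-monoˡ-≤ (width-nonneg (suc m)) (ℕ.s≤s (ℕₚ.m≤n+m (suc m) m)) ⟩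
    (suc m ℕ.+ suc m) · h             ≡⟨ ×-homo-+ h (suc m) (suc m) ⟩
    suc m · h + suc m · h             ≡⟨ ×-distrib-+ h h (suc m) ⟨
    suc m · (h + h)                   ≡⟨ cong (suc m ·_) (½+½ (width m)) ⟩
    suc m · width m                   ≤⟨ suc·width≤1 m ⟩
    1ℚ                                ∎
    where h = width (suc m)

-- The Bolzano-Weierstrass theorem by bisection

module BolzanoWeierstrass (em : ExcludedMiddle 0ℓ) where

  Infinite : (ℕ → Set) → Set
  Infinite S = ∀ N → ∃ λ k → N ℕ.≤ k × S k

  record Stage (x : ℕ → ℚ) (w : ℚ) : Set₁ where
    field
      S        : ℕ → Set
      infinite : Infinite S
      lo       : ℚ
      lower    : ∀ {k} → S k → lo ≤ x k
      upper    : ∀ {k} → S k → x k ≤ lo + w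

  open Stage

  -- Excluded middle decides whether the lower half of the interval still contains infinitely many
  -- terms; otherwise the upper half does.
  refine : ∀ {x w} (s : Stage x w) → ∃ λ (s′ : Stage x (½ * w)) → ∀ {k} → S s′ k → S s k
  refine {x} {w} s with em {Infinite λ k → S s k × x k ≤ lo s + ½ * w}
  ... | yes inf = record
        { S = λ k → S s k × x k ≤ lo s + ½ * w
        ; infinite = inf
        ; lo = lo s
        ; lower = lower s ∘ proj₁
        ; upper = proj₂
        } , proj₁
  ... | no ¬inf = record
        { S = λ k → S s k × lo s + ½ * w ≤ x k
        ; infinite = inf
        ; lo = lo s + ½ * w
        ; lower = proj₂
        ; upper = λ {k} (sk , _) → subst (x k ≤_)
            (sym (trans (ℚₚ.+-assoc (lo s) _ _) (cong (lo s +_) (½+½ w)))) (upper s sk)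
        } , proj₁
    where
    inf : Infinite λ k → S s k × lo s + ½ * w ≤ x k
    inf N with em {∃ λ k → N ℕ.≤ k × S s k × lo s + ½ * w ≤ x k}
    ... | yes found = found
    -- With no index from N on in the upper half, all indices of the stage from N on fall in the
    -- lower half, which would make that half infinite.
    ... | no  ¬found = ⊥-elim (¬inf λ N′ →
      let k , le , sk = infinite s (N ℕ.⊔ N′)
      in k , ℕₚ.m⊔n≤o⇒n≤o N N′ le , sk ,
         ℚₚ.<⇒≤ (ℚₚ.≰⇒> λ h → ¬found (k , ℕₚ.m⊔n≤o⇒m≤o N N′ le , sk , h)))

  -- `φ n` is an index of stage n that is at least n. The condition `n ≤ φ n` takes the place of
  -- strict monotonicity.
  cauchy-subsequence : ∀ {x} → (∀ n → 0ℚ ≤ x n) → (∀ n → x n ≤ 1ℚ) →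
                       ∃ λ φ → (∀ n → n ℕ.≤ φ n) × Cauchy (x ∘ φ)
  cauchy-subsequence {x} 0≤x x≤1 = φ , (λ n → proj₁ (proj₂ (choose n))) , cauchy
    where
    stage : ∀ m → Stage x (width m)
    stage zero = record
      -- An inhabited proposition: the first stage contains every index.
      { S = λ _ → 0ℚ ≤ 0ℚ
      ; infinite = λ N → N , ℕₚ.≤-refl , ℚₚ.≤-refl
      ; lo = 0ℚ
      ; lower = λ _ → 0≤x _
      ; upper = λ _ → x≤1 _
      }
    stage (suc m) = proj₁ (refine (stage m))
    nested : ∀ {M m} → M ℕ.≤′ m → ∀ {k} → S (stage m) k → S (stage M) k
    nested ℕ.≤′-refl s = s
    nested {m = suc m} (ℕ.≤′-step M≤m) s = nested M≤m (proj₂ (refine (stage m)) s)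
    choose : ∀ m → ∃ λ k → m ℕ.≤ k × S (stage m) k
    choose m = infinite (stage m) m
    φ : ℕ → ℕ
    φ = proj₁ ∘ choose
    late : ∀ {M} n → M ℕ.≤ n → S (stage M) (φ n)
    late n M≤n = nested (ℕₚ.≤⇒≤′ M≤n) (proj₂ (proj₂ (choose n)))
    close : ∀ {M ε} → width M ≤ ε → ∀ m n → M ℕ.≤ m → M ℕ.≤ n → x (φ m) ≤ x (φ n) + ε
    close {M} {ε} w≤ε m n M≤m M≤n = begin
      x (φ m)                 ≤⟨ upper (stage M) (late m M≤m) ⟩
      lo (stage M) + width M  ≤⟨ ℚₚ.+-mono-≤ (lower (stage M) (late n M≤n)) w≤ε ⟩
      x (φ n) + ε             ∎
      where open ℚₚ.≤-Reasoning
    cauchy : Cauchy (x ∘ φ)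
    cauchy 0<ε =
      let M , small = unit-vanishes 0<ε
          w≤ε = ℚₚ.≤-trans (width≤unit M) (small M ℕₚ.≤-refl)
      in M , λ m n M≤m M≤n → close w≤ε m n M≤m M≤n , close w≤ε n m M≤n M≤m

  bolzano-weierstrass : ∀ {d} {x : Fin d → ℕ → ℚ} →
    (∀ j n → 0ℚ ≤ x j n) → (∀ j n → x j n ≤ 1ℚ) →
    ∃ λ φ → (∀ n → n ℕ.≤ φ n) × (∀ j → Cauchy (x j ∘ φ))
  bolzano-weierstrass {zero}  0≤x x≤1 = id , (λ n → ℕₚ.≤-refl) , λ ()
  bolzano-weierstrass {suc d} {x} 0≤x x≤1 =
    let φ , n≤φ , cφ = bolzano-weierstrass {d} {x ∘ suc} (0≤x ∘ suc) (x≤1 ∘ suc)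
        ψ , n≤ψ , cψ = cauchy-subsequence (0≤x zero ∘ φ) (x≤1 zero ∘ φ)
    in φ ∘ ψ , (λ n → ℕₚ.≤-trans (n≤ψ n) (n≤φ (ψ n))) , λ where
         zero    → cψ
         (suc j) → cauchy-reindex {x (suc j) ∘ φ} n≤ψ (cφ j)

-- Weighted sums

weigh : ∀ {v} → (Fin v → ℕ) → (Fin v → ℚ) → ℚ
weigh w a = sum λ u → w u · a u

-- An error ε in every entry costs at most the total weight times ε. A common bound `C` lets one
-- tolerance serve several weightings.
weigh-approx : ∀ {v} (w : Fin v → ℕ) {a b ε C} → 0ℚ ≤ ε → sumℕ w ℕ.≤ C →
               (∀ u → a u ≤ b u + ε) → weigh w a ≤ weigh w b + C · ε
weigh-approx w {a} {b} {ε} {C} 0≤ε w≤C a≤ = begin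
  weigh w a                                      ≤⟨ sum-mono (λ u → ·-monoʳ-≤ (w u) (a≤ u)) ⟩
  sum (λ u → w u · (b u + ε))                    ≡⟨ sum-cong-≗ (λ u → ×-distrib-+ (b u) ε (w u)) ⟩
  sum (λ u → w u · b u + w u · ε)                ≡⟨ ∑-distrib-+ (λ u → w u · b u) (λ u → w u · ε) ⟩
  weigh w b + sum (λ u → w u · ε)                ≡⟨ cong (weigh w b +_) (sum-· w ε) ⟩
  weigh w b + sumℕ w · ε                         ≤⟨ ℚₚ.+-monoʳ-≤ (weigh w b) (·-monoˡ-≤ 0≤ε w≤C) ⟩
  weigh w b + C · ε                              ∎
  where open ℚₚ.≤-Reasoning

weigh-0 : ∀ {v} (w : Fin v → ℕ) → weigh w (λ _ → 0ℚ) ≡ 0ℚ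
weigh-0 w = trans (sum-· w 0ℚ) (·-zeroʳ (sumℕ w))

term≤sumℕ : ∀ {n} (f : Fin n → ℕ) i → f i ℕ.≤ sumℕ f
term≤sumℕ f zero    = ℕₚ.m≤m+n _ _
term≤sumℕ f (suc i) = ℕₚ.≤-trans (term≤sumℕ (f ∘ suc) i) (ℕₚ.m≤n+m _ (f zero))

-- Real numbers

cauchy : ∀ x → Cauchy (seq x)
cauchy x 0<ε = let N , p = isCauchy x _ 0<ε in
  N , λ m n N≤m N≤n → ∣-∣≤⇒within (ℚₚ.<⇒≤ (p m n N≤m N≤n))

fromCauchy : ∀ x → Cauchy x → ℝ
fromCauchy x c = mkℝ x λ ε 0<ε →
  -- `Within` is non-strict and `IsCauchy` is strict, hence an error strictly below ε.
  let r , 0<r , r<ε = ℚₚ.<-dense 0<ε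
      N , p = c 0<r
  in N , λ m n N≤m N≤n → ℚₚ.≤-<-trans (within⇒∣-∣≤ (p m n N≤m N≤n)) r<ε

≈⇒within : ∀ {x y} → x ≈ y → ∀ {ε} → 0ℚ < ε →
           Eventually λ n → Within ε (seq x n) (seq y n)
≈⇒within x≈y 0<ε = ev-map (λ lt → ∣-∣≤⇒within (ℚₚ.<⇒≤ lt)) (limit≡0 x≈y _ 0<ε)

const : ℚ → ℝ
const q = fromCauchy (λ _ → q) λ 0<ε → 0 , λ _ _ _ _ → p≤p+q q (ℚₚ.<⇒≤ 0<ε) , p≤p+q q (ℚₚ.<⇒≤ 0<ε)

0<const : ∀ {q} → 0ℚ < q → 0ℝ <ℝ const q
0<const 0<q = let r , 0<r , r<q = ℚₚ.<-dense 0<q in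
  mk< r 0 0<r λ _ _ → subst (_< _) (sym (ℚₚ.+-identityˡ r)) r<q

seq-sumℝ : ∀ {m} (x : Fin m → ℝ) n → seq (sumℝ x) n ≡ sum λ i → seq (x i) n
seq-sumℝ {zero}  x n = refl
seq-sumℝ {suc m} x n = cong (seq (x zero) n +_) (seq-sumℝ (x ∘ suc) n)

half : ∀ {ε} → 0ℚ < ε → ∃ λ r → 0ℚ < r × r + r ≤ ε
half {ε} 0<ε = let r , 0<r , le = fraction 2 0<ε in
  r , 0<r , subst (_≤ ε) (cong (r +_) (ℚₚ.+-identityʳ r)) le

-- Past some `K` both sequences vary by at most `r`, and one rational comparison at `K` decides:
-- either the bound spreads to all later indices, or the excess `D` at `K` yields a gap proving
-- `x <ℝ y`.
≮⇒eventually-≤ : ∀ {x y} → ¬ x <ℝ y → ∀ {ε} → 0ℚ < ε →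
                 Eventually λ n → seq y n ≤ seq x n + ε
≮⇒eventually-≤ {x} {y} x≮y {ε} 0<ε =
  let q , 0<q , q+q≤ε = half 0<ε
      r , 0<r , r+r≤q = half 0<q
      M , p = cauchy x 0<r
      N , p′ = cauchy y 0<r
      K = M ℕ.⊔ N
      tail : ∀ n → K ℕ.≤ n →
             (seq y n ≤ seq y K + r × seq y K ≤ seq y n + r) ×
             (seq x n ≤ seq x K + r × seq x K ≤ seq x n + r)
      tail n K≤n = p′ n K (ℕₚ.m⊔n≤o⇒n≤o M N K≤n) (ℕₚ.m≤n⊔m M N) ,
                   p n K (ℕₚ.m⊔n≤o⇒m≤o M N K≤n) (ℕₚ.m≤m⊔n M N)
  in case q r 0<q q+q≤ε r+r≤q K tail
  where
  open ℚₚ.≤-Reasoning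
  case : ∀ q r → 0ℚ < q → q + q ≤ ε → r + r ≤ q → ∀ K →
         (∀ n → K ℕ.≤ n →
             (seq y n ≤ seq y K + r × seq y K ≤ seq y n + r) ×
             (seq x n ≤ seq x K + r × seq x K ≤ seq x n + r)) →
         Eventually λ n → seq y n ≤ seq x n + ε
  case q r 0<q q+q≤ε r+r≤q K tail with seq y K ℚₚ.≤? seq x K + q
  ... | yes le = K , λ n K≤n →
    let (y≤ , _) , (_ , x≤) = tail n K≤n
    in ≤+-weaken {q = seq x n}
         (begin
           (r + q) + r ≡⟨ ℚₚ.+-comm (r + q) r ⟩
           r + (r + q) ≡⟨ ℚₚ.+-assoc r r q ⟨
           (r + r) + q ≤⟨ ℚₚ.+-monoˡ-≤ q r+r≤q ⟩
           q + q       ≤⟨ q+q≤ε ⟩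
           ε           ∎)
         (≤+-trans {r = seq x n} y≤ (≤+-trans {r = seq x n} le x≤))
  ... | no nle = ⊥-elim (x≮y (mk< gap K 0<gap λ n K≤n →
    let (_ , y≤) , (x≤ , _) = tail n K≤n
    in lemma n y≤ x≤))
    where
    D = seq y K - (seq x K + q)
    0<D : 0ℚ < D
    0<D = subst (_< D) (ℚₚ.+-inverseʳ (seq x K + q)) (ℚₚ.+-monoˡ-< _ (ℚₚ.≰⇒> nle))
    gap = proj₁ (ℚₚ.<-dense 0<D)
    0<gap = proj₁ (proj₂ (ℚₚ.<-dense 0<D))
    gap<D = proj₂ (proj₂ (ℚₚ.<-dense 0<D))
    lemma : ∀ n → seq y K ≤ seq y n + r → seq x n ≤ seq x K + r → seq x n + gap < seq y n
    lemma n y≤ x≤ = ℚₚ.≰⇒> λ h → ℚₚ.<-irrefl refl (begin-strict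
      seq y K                            ≤⟨ ≤+-trans {r = seq x K + r} y≤ (ℚₚ.≤-trans h (ℚₚ.+-monoˡ-≤ gap x≤)) ⟩
      seq x K + r + (gap + r)            ≡⟨ shuffle (seq x K) r gap ⟩
      seq x K + (r + r) + gap            ≤⟨ ℚₚ.+-monoˡ-≤ gap (ℚₚ.+-monoʳ-≤ (seq x K) r+r≤q) ⟩
      seq x K + q + gap                  <⟨ ℚₚ.+-monoʳ-< (seq x K + q) gap<D ⟩
      seq x K + q + D                    ≡⟨ q+[p-q] (seq y K) (seq x K + q) ⟩
      seq y K                            ∎)
      where
      open +-*-Solver
      shuffle : ∀ a r g → a + r + (g + r) ≡ a + (r + r) + g
      shuffle = solve 3 (λ a r g → a :+ r :+ (g :+ r) := a :+ (r :+ r) :+ g) refl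

0<-resp-≈ : ∀ {x y} → x ≈ y → 0ℝ <ℝ x → 0ℝ <ℝ y
0<-resp-≈ {x} {y} x≈y (mk< g N 0<g 0<x) =
  let r , 0<r , r+r≤g = half 0<g
      M , p = ≈⇒within x≈y 0<r
  in mk< r (N ℕ.⊔ M) 0<r λ n le → begin-strict
       0ℚ + r    ≡⟨ ℚₚ.+-identityˡ r ⟩
       r         <⟨ ℚₚ.≰⇒> (λ y≤r → ℚₚ.<-irrefl refl (begin-strict
         g               ≡⟨ ℚₚ.+-identityˡ g ⟨
         0ℚ + g          <⟨ 0<x n (ℕₚ.m⊔n≤o⇒m≤o N M le) ⟩
         seq x n         ≤⟨ proj₁ (p n (ℕₚ.m⊔n≤o⇒n≤o N M le)) ⟩
         seq y n + r     ≤⟨ ℚₚ.+-monoˡ-≤ r y≤r ⟩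
         r + r           ≤⟨ r+r≤g ⟩
         g               ∎)) ⟩
       seq y n   ∎
  where open ℚₚ.≤-Reasoning

∣-∣<ℝ⇒within : ∀ {x y ε} → ∣ x -ℝ y ∣ℝ <ℝ const ε → Eventually λ n → Within ε (seq x n) (seq y n)
∣-∣<ℝ⇒within (mk< g N 0<g lt) = N , λ n N≤n →
  ∣-∣≤⇒within (ℚₚ.≤-trans (p≤p+q _ (ℚₚ.<⇒≤ 0<g)) (ℚₚ.<⇒≤ (lt n N≤n)))

-- Subsets of a finite set cut out by decidable predicates

comprehension : ∀ {n} {P : Fin n → Set} → Decidable P → Subset n
comprehension P? = Vec.tabulate (does ∘ P?)

∈-comprehension : ∀ {n} {P : Fin n → Set} (P? : Decidable P) j → j ∈ comprehension P? ⇔ P j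
∈-comprehension {P = P} P? j = mk⇔ to from
  where
  to : j ∈ comprehension P? → P j
  to j∈ with P? j | trans (sym (Vecₚ.lookup∘tabulate (does ∘ P?) j)) (Vecₚ.[]=⇒lookup j∈)
  ... | yes p | _ = p
  from : P j → j ∈ comprehension P?
  from p = Vecₚ.lookup⇒[]= j (comprehension P?)
    (trans (Vecₚ.lookup∘tabulate (does ∘ P?) j) (dec-true (P? j) p))

-- Stick breaking: the grid point t of the cube breaks a stick of length r
-- into the pieces t₀ ⊓ r, t₁ ⊓ (r ∸ t₀), …; the rest is the coordinate zero.
stick : ∀ {d} → ℕ → Vec ℕ d → Fin (suc d) → ℕ
stick r []       j             = r
stick r (t ∷ ts) zero          = stick (r ∸ t) ts zero
stick r (t ∷ ts) (suc zero)    = t ℕ.⊓ r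
stick r (t ∷ ts) (suc (suc j)) = stick (r ∸ t) ts (suc j)

sum-stick : ∀ {d} r (t : Vec ℕ d) → sumℕ (stick r t) ≡ r
sum-stick r []       = ℕₚ.+-identityʳ r
sum-stick r (t ∷ ts) = begin
  s₀ ℕ.+ (t ℕ.⊓ r ℕ.+ s′)   ≡⟨ ℕₚ.+-assoc s₀ (t ℕ.⊓ r) s′ ⟨
  s₀ ℕ.+ t ℕ.⊓ r ℕ.+ s′     ≡⟨ cong (ℕ._+ s′) (ℕₚ.+-comm s₀ (t ℕ.⊓ r)) ⟩
  t ℕ.⊓ r ℕ.+ s₀ ℕ.+ s′     ≡⟨ ℕₚ.+-assoc (t ℕ.⊓ r) s₀ s′ ⟩
  t ℕ.⊓ r ℕ.+ (s₀ ℕ.+ s′)   ≡⟨ cong (t ℕ.⊓ r ℕ.+_) (sum-stick (r ∸ t) ts) ⟩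
  t ℕ.⊓ r ℕ.+ (r ∸ t)       ≡⟨ ℕₚ.m⊓n+n∸m≡n t r ⟩
  r                         ∎
  where
  open ≡-Reasoning
  s₀ = stick (r ∸ t) ts zero
  s′ = sumℕ (λ j → stick (r ∸ t) ts (suc j))

stick-low : ∀ {d} r (t : Vec ℕ d) i → lookup t i ≡ 0 → stick r t (suc i) ≡ 0
stick-low r (t ∷ ts) zero    refl = refl
stick-low r (t ∷ ts) (suc i) eq   = stick-low (r ∸ t) ts i eq

stick-0 : ∀ {d} (t : Vec ℕ d) → stick 0 t zero ≡ 0
stick-0 []       = refl
stick-0 (t ∷ ts) = trans (cong (λ r → stick r ts zero) (ℕₚ.0∸n≡0 t)) (stick-0 ts)

-- A cut at least as long as the original stick uses up whatever is left of it.
stick-high : ∀ {d} r (t : Vec ℕ d) i → r ℕ.≤ lookup t i → stick r t zero ≡ 0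
stick-high r (t ∷ ts) zero    r≤t =
  trans (cong (λ r → stick r ts zero) (ℕₚ.m≤n⇒m∸n≡0 r≤t)) (stick-0 ts)
stick-high r (t ∷ ts) (suc i) r≤ =
  stick-high (r ∸ t) ts i (ℕₚ.≤-trans (ℕₚ.m∸n≤m r t) r≤)

-- `e` bounds the excess of the first remaining stick over the second. The cuts differ by at most
-- one, so each of the d cuts raises this bound by at most one.
stick-lipschitz : ∀ {d} {r r′} e (t t′ : Vec ℕ d) →
  (∀ i → lookup t i ℕ.≤ suc (lookup t′ i) × lookup t′ i ℕ.≤ suc (lookup t i)) →
  r ℕ.≤ r′ ℕ.+ e → ∀ j → stick r t j ℕ.≤ stick r′ t′ j ℕ.+ (e ℕ.+ d)
stick-lipschitz {r′ = r′} e [] [] _ r≤ j =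
  subst (λ z → _ ℕ.≤ r′ ℕ.+ z) (sym (ℕₚ.+-identityʳ e)) r≤
stick-lipschitz {suc d} {r} {r′} e (t ∷ ts) (t′ ∷ ts′) near r≤ = go
  where
  rest : r ∸ t ℕ.≤ (r′ ∸ t′) ℕ.+ suc e
  rest = begin
    r ∸ t                        ≤⟨ ℕₚ.∸-monoˡ-≤ t r≤ ⟩
    (r′ ℕ.+ e) ∸ t               ≤⟨ ℕₚ.m≤n+o⇒m∸n≤o (r′ ℕ.+ e) t lem ⟩
    (r′ ∸ t′) ℕ.+ suc e          ∎
    where
    open ℕₚ.≤-Reasoning
    lem : r′ ℕ.+ e ℕ.≤ t ℕ.+ ((r′ ∸ t′) ℕ.+ suc e)
    lem = begin
      r′ ℕ.+ e                          ≤⟨ ℕₚ.+-monoˡ-≤ e (ℕₚ.m≤n+m∸n r′ t′) ⟩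
      t′ ℕ.+ (r′ ∸ t′) ℕ.+ e            ≤⟨ ℕₚ.+-monoˡ-≤ e (ℕₚ.+-monoˡ-≤ (r′ ∸ t′) (proj₂ (near zero))) ⟩
      suc t ℕ.+ (r′ ∸ t′) ℕ.+ e         ≡⟨ ℕₚ.+-suc (t ℕ.+ (r′ ∸ t′)) e ⟨
      t ℕ.+ (r′ ∸ t′) ℕ.+ suc e         ≡⟨ ℕₚ.+-assoc t (r′ ∸ t′) (suc e) ⟩
      t ℕ.+ ((r′ ∸ t′) ℕ.+ suc e)       ∎
  tails : ∀ j → stick (r ∸ t) ts j ℕ.≤ stick (r′ ∸ t′) ts′ j ℕ.+ (e ℕ.+ suc d)
  tails j = subst (λ z → stick (r ∸ t) ts j ℕ.≤ stick (r′ ∸ t′) ts′ j ℕ.+ z) (sym (ℕₚ.+-suc e d))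
    (stick-lipschitz (suc e) ts ts′ (near ∘ suc) rest j)
  go : ∀ j → stick r (t ∷ ts) j ℕ.≤ stick r′ (t′ ∷ ts′) j ℕ.+ (e ℕ.+ suc d)
  go zero          = tails zero
  go (suc (suc j)) = tails (suc j)
  go (suc zero)    = begin
    t ℕ.⊓ r
      ≤⟨ ℕₚ.⊓-mono-≤ t≤ (ℕₚ.≤-trans r≤ (ℕₚ.+-monoʳ-≤ r′ (ℕₚ.m≤m+n e (suc d)))) ⟩
    (t′ ℕ.+ (e ℕ.+ suc d)) ℕ.⊓ (r′ ℕ.+ (e ℕ.+ suc d)) ≡⟨ ℕₚ.+-distribʳ-⊓ (e ℕ.+ suc d) t′ r′ ⟨
    (t′ ℕ.⊓ r′) ℕ.+ (e ℕ.+ suc d)                     ∎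
    where
    open ℕₚ.≤-Reasoning
    t≤ : t ℕ.≤ t′ ℕ.+ (e ℕ.+ suc d)
    t≤ = begin
      t                       ≤⟨ proj₁ (near zero) ⟩
      suc t′                  ≡⟨ ℕₚ.+-comm 1 t′ ⟩
      t′ ℕ.+ 1                ≤⟨ ℕₚ.+-monoʳ-≤ t′ (ℕₚ.≤-trans (ℕ.s≤s ℕ.z≤n) (ℕₚ.m≤n+m (suc d) e)) ⟩
      t′ ℕ.+ (e ℕ.+ suc d)    ∎

-- Balancing the loads of a face-preserving map

-- On the sides x = 0 and x = k of the cube the sign is prescribed, which matters
-- when both P and Q hold there.
orient : ∀ {P Q : Set} (x k : ℕ) → 0 ≢ k → (x ≡ 0 → P) → (x ≡ k → Q) → P ⊎ Q →
         ∃ λ b → (b ≡ false → P) × (b ≡ true → Q) × (x ≡ 0 → b ≡ false) × (x ≡ k → b ≡ true)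
orient x k 0≢k low high either with x ℕₚ.≟ 0 | x ℕₚ.≟ k | either
... | yes eq | _      | _      = false , (λ _ → low eq) , (λ ()) , (λ _ → refl) ,
                                 λ eq′ → ⊥-elim (0≢k (trans (sym eq) eq′))
... | no neq | yes eq | _      = true , (λ ()) , (λ _ → high eq) , (λ eq′ → ⊥-elim (neq eq′)) , λ _ → refl
... | no neq | no ne′ | inj₁ p = false , (λ _ → p) , (λ ()) , (λ _ → refl) , λ eq → ⊥-elim (ne′ eq)
... | no neq | no ne′ | inj₂ q = true , (λ ()) , (λ _ → q) , (λ eq → ⊥-elim (neq eq)) , λ _ → refl

≤⇒≮ : ∀ {x y} → (∀ n → seq x n ≤ seq y n) → ¬ y <ℝ x
≤⇒≮ x≤y (mk< g N 0<g lt) = ℚₚ.<-irrefl refl (ℚₚ.<-≤-trans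
  (ℚₚ.≤-<-trans (p≤p+q _ (ℚₚ.<⇒≤ 0<g)) (lt N ℕₚ.≤-refl)) (x≤y N))

≗⇒≈ : ∀ {x y} → (∀ n → seq x n ≡ seq y n) → x ≈ y
≗⇒≈ {x} {y} eq = mk≈ λ ε 0<ε → 0 , λ n _ →
  subst (λ z → ∣ z ∣ < ε) (sym (trans (cong (_- seq y n) (eq n)) (ℚₚ.+-inverseʳ (seq y n)))) 0<ε

-- Points of the standard simplex and its compactness

module StandardSimplex (em : ExcludedMiddle 0ℓ) (d : ℕ) where

  Δ : SimplicialComplex (suc d)
  Δ = fullSimplex (suc d)

  -- Positivity of a real number is not decidable constructively, so the support comes from excluded
  -- middle.
  point : (x : Fin (suc d) → ℝ) → (∀ j → 0ℝ ≤ℝ x j) → sumℝ x ≈ 1ℝ → ∥ Δ ∥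
  point x 0≤x sum≈1 = record
    { coord       = x
    ; nonneg      = 0≤x
    ; sum≈1       = sum≈1
    ; support     = comprehension (λ j → em {0ℝ <ℝ x j}) , _
    ; support-def = ∈-comprehension (λ j → em {0ℝ <ℝ x j})
    }

  pointwise : (x : Fin (suc d) → ℝ) → (∀ j n → 0ℚ ≤ seq (x j) n) →
              (∀ n → sum (λ j → seq (x j) n) ≡ 1ℚ) → ∥ Δ ∥
  pointwise x 0≤x sum≡1 = point x (λ j → ≤⇒≮ {0ℝ} {x j} (0≤x j))
    (≗⇒≈ λ n → trans (seq-sumℝ x n) (sum≡1 n))

  open BolzanoWeierstrass em

  -- The Cauchy subsequence itself represents the limit, whose coordinates are therefore termwise
  -- nonnegative with sum exactly one.
  compactness : ∀ {x : ℕ → Fin (suc d) → ℚ} →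
    (∀ m j → 0ℚ ≤ x m j) → (∀ m j → x m j ≤ 1ℚ) → (∀ m → sum (x m) ≡ 1ℚ) →
    ∃ λ y → ∀ {e} → 0ℚ < e → ∀ M → ∃ λ m → M ℕ.≤ m ×
      Eventually λ n → ∀ j → Within e (seq (coord y j) n) (x m j)
  compactness {x} 0≤x x≤1 sum≡1 = limit , cluster
    where
    subsequence : ∃ λ φ → (∀ n → n ℕ.≤ φ n) × (∀ j → Cauchy λ n → x (φ n) j)
    subsequence = bolzano-weierstrass {x = λ j m → x m j} (λ j m → 0≤x m j) (λ j m → x≤1 m j)
    φ : ℕ → ℕ
    φ = proj₁ subsequence
    limit : ∥ Δ ∥
    limit = pointwise (λ j → fromCauchy (λ n → x (φ n) j) (proj₂ (proj₂ subsequence) j))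
      (λ j n → 0≤x (φ n) j) (λ n → sum≡1 (φ n))
    cluster : ∀ {e} → 0ℚ < e → ∀ M → ∃ λ m → M ℕ.≤ m ×
      Eventually λ n → ∀ j → Within e (seq (coord limit j) n) (x m j)
    cluster {e} 0<e M =
      let N , c = ev-∀ {P = λ j n → ∀ n′ → n ℕ.≤ n′ → Within e (x (φ n′) j) (x (φ n) j)}
                    λ j → let N , c = proj₂ (proj₂ subsequence) j 0<e in
                      N , λ n N≤n n′ n≤n′ → c n′ n (ℕₚ.≤-trans N≤n n≤n′) N≤n
          n₀ = M ℕ.⊔ N
      in φ n₀ , ℕₚ.≤-trans (ℕₚ.m≤m⊔n M N) (proj₁ (proj₂ subsequence) n₀) ,
         n₀ , λ n n₀≤n j → c n₀ (ℕₚ.m≤n⊔m M N) j n n₀≤n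

module Balance (em : ExcludedMiddle 0ℓ) {d v : ℕ} (K : SimplicialComplex v)
  (f : SMap K (fullSimplex (suc d)))
  (h : Homeomorphism K (fullSimplex (suc d)))
  (h-support : ∀ k → proj₁ (support (Homeomorphism.apply h k)) ≡ image f (support k))
  (A : Fin (suc d) → Fin v → ℕ)
  (carried : ∀ (σ : Face K) j u → u ∈ proj₁ σ → j ∉ image f σ → A j u ≡ 0)
  where

  open StandardSimplex em d

  h⁻¹ : ∥ Δ ∥ → ∥ K ∥
  h⁻¹ = Inverse.from (Homeomorphism.bijection h)

  approximation : ∥ K ∥ → ℕ → Fin v → ℚ
  approximation k n u = seq (coord k u) n

  -- The n-th rational approximation of the linear function F j. Inequalities between these
  -- functions are stated for all large n and up to an error.
  F : Fin (suc d) → ∥ K ∥ → ℕ → ℚ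
  F j k n = weigh (A j) (approximation k n)

  C : ℕ
  C = sumℕ λ j → sumℕ (A j)

  F-approx : ∀ j {a b : Fin v → ℚ} {ε} → 0ℚ ≤ ε → (∀ u → a u ≤ b u + ε) →
             weigh (A j) a ≤ weigh (A j) b + C · ε
  F-approx j 0≤ε = weigh-approx (A j) 0≤ε (term≤sumℕ (λ j → sumℕ (A j)) j)

  -- `e` is the error of a load when the coordinates are known up to `ε`; the estimates below
  -- collect two or three such errors.
  tolerance : ∀ {η} → 0ℚ < η → ∃₂ λ e ε → 0ℚ < ε × C · ε ≤ e × 4 · e ≤ η × 0ℚ < e
  tolerance 0<η =
    let e , 0<e , 4e≤η = fraction 4 0<η
        ε , 0<ε , Cε≤e = fraction C 0<e
    in e , ε , 0<ε , Cε≤e , 4e≤η , 0<e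

  approximately-nonneg : ∀ k {ε} → 0ℚ < ε → Eventually λ n → ∀ u → 0ℚ ≤ approximation k n u + ε
  approximately-nonneg k 0<ε =
    ev-∀ λ u → ≮⇒eventually-≤ {coord k u} {0ℝ} (nonneg k u) 0<ε

  approximately-supported : ∀ k {ε} → 0ℚ < ε →
    Eventually λ n → ∀ u → u ∉ proj₁ (support k) → approximation k n u ≤ 0ℚ + ε
  approximately-supported k {ε} 0<ε = ev-∀ λ u → bound u
    where
    bound : ∀ u → Eventually λ n → u ∉ proj₁ (support k) → approximation k n u ≤ 0ℚ + ε
    bound u with u ∈? proj₁ (support k)
    ... | yes u∈ = always λ _ u∉ → ⊥-elim (u∉ u∈)
    ... | no  u∉ = ev-map (λ {n} (le : approximation k n u ≤ 0ℚ + ε) _ → le) (≮⇒eventually-≤ {0ℝ} {coord k u}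
                     (λ 0<u → u∉ (Equivalence.from (support-def k u) 0<u)) 0<ε)

  -- Since h (h⁻¹ y) equals y, its support misses j. That support is the image under f of the
  -- support of h⁻¹ y, so `carried` applies.
  off-carrier : ∀ y j → ¬ 0ℝ <ℝ coord y j → ∀ u → u ∈ proj₁ (support (h⁻¹ y)) → A j u ≡ 0
  off-carrier y j ≮ u u∈ = carried (support (h⁻¹ y)) j u u∈ λ j∈ →
    ≮ (0<-resp-≈ (Inverse.strictlyInverseˡ (Homeomorphism.bijection h) y j)
        (Equivalence.to (support-def (Homeomorphism.apply h (h⁻¹ y)) j)
          (subst (j ∈_) (sym (h-support (h⁻¹ y))) j∈)))

  -- On the facet opposite to the vertex j the load F j vanishes, while all loads are nonnegative;
  -- the approximations inherit both facts up to an error.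
  boundary : ∀ y j → ¬ 0ℝ <ℝ coord y j → ∀ j′ {η} → 0ℚ < η →
             Eventually λ n → F j (h⁻¹ y) n ≤ F j′ (h⁻¹ y) n + η
  boundary y j ≮ j′ {η} 0<η =
    let e , ε , 0<ε , Cε≤e , 4e≤η , 0<e = tolerance 0<η
    in ev-zip (λ {n} pos sup → bound e ε (ℚₚ.<⇒≤ 0<ε) Cε≤e (4e≤η⇒2e≤η 0<e 4e≤η) n pos sup)
         (approximately-nonneg k 0<ε) (approximately-supported k 0<ε)
    where
    k = h⁻¹ y
    bound : ∀ e ε → 0ℚ ≤ ε → C · ε ≤ e → e + e ≤ η → ∀ n →
            (∀ u → 0ℚ ≤ approximation k n u + ε) →
            (∀ u → u ∉ proj₁ (support k) → approximation k n u ≤ 0ℚ + ε) →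
            F j k n ≤ F j′ k n + η
    bound e ε 0≤ε Cε≤e e+e≤η n pos sup = ≤+-weaken {q = F j′ k n} e+e≤η
      (≤+-trans {r = F j′ k n}
        (≤+-weaken {q = 0ℚ} Cε≤e upper)
        (≤+-weaken {q = F j′ k n} Cε≤e lower))
      where
      open ℚₚ.≤-Reasoning
      lower : 0ℚ ≤ F j′ k n + C · ε
      lower = subst (_≤ F j′ k n + C · ε) (weigh-0 (A j′)) (F-approx j′ 0≤ε pos)
      termwise : ∀ u → A j u · approximation k n u ≤ A j u · ε
      -- On the support the weight is zero; off it the coordinate is at most ε.
      termwise u with u ∈? proj₁ (support k)
      ... | yes u∈ = subst (λ w → w · approximation k n u ≤ w · ε) (sym (off-carrier y j ≮ u u∈)) ℚₚ.≤-refl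
      ... | no  u∉ = ·-monoʳ-≤ (A j u) (subst (_ ≤_) (ℚₚ.+-identityˡ ε) (sup u u∉))
      upper : F j k n ≤ 0ℚ + C · ε
      upper = begin
        F j k n                 ≤⟨ sum-mono termwise ⟩
        weigh (A j) (λ _ → ε)   ≤⟨ F-approx j {b = λ _ → 0ℚ} 0≤ε (λ _ → ℚₚ.≤-reflexive (sym (ℚₚ.+-identityˡ ε))) ⟩
        weigh (A j) (λ _ → 0ℚ) + C · ε ≡⟨ cong (_+ C · ε) (weigh-0 (A j)) ⟩
        0ℚ + C · ε              ∎

  -- The two loads are compared, as rationals, at one index past which the coordinates vary by at
  -- most ε; η absorbs that variation.
  dichotomy : ∀ k j j′ {η} → 0ℚ < η →
    Eventually (λ n → F j k n ≤ F j′ k n + η) ⊎ Eventually (λ n → F j′ k n ≤ F j k n + η)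
  dichotomy k j j′ {η} 0<η =
    let e , ε , 0<ε , Cε≤e , 4e≤η , 0<e = tolerance 0<η
        N , p = uniform 0<ε
    in split e ε N (ℚₚ.<⇒≤ 0<ε) Cε≤e (4e≤η⇒2e≤η 0<e 4e≤η) p
    where
    uniform : ∀ {ε} → 0ℚ < ε → ∃ λ N → ∀ n → N ℕ.≤ n → ∀ u →
              Within ε (approximation k n u) (approximation k N u)
    uniform {ε} 0<ε =
      let N , p = ev-∀ {P = λ u n → ∀ n′ → n ℕ.≤ n′ → Within ε (approximation k n′ u) (approximation k n u)}
                    λ u → let M , c = cauchy (coord k u) 0<ε in
                      M , λ n M≤n n′ n≤n′ → c n′ n (ℕₚ.≤-trans M≤n n≤n′) M≤n
      in N , λ n N≤n u → p N ℕₚ.≤-refl u n N≤n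
    compare : ∀ e ε N → 0ℚ ≤ ε → C · ε ≤ e → e + e ≤ η →
      (∀ n → N ℕ.≤ n → ∀ u → Within ε (approximation k n u) (approximation k N u)) →
      ∀ j j′ → F j k N ≤ F j′ k N → Eventually λ n → F j k n ≤ F j′ k n + η
    compare e ε N 0≤ε Cε≤e e+e≤η p j j′ le = N , λ n N≤n →
      ≤+-weaken {q = F j′ k n} e+e≤η (≤+-trans {r = F j′ k n}
        (≤+-weaken {q = F j′ k N} Cε≤e (ℚₚ.≤-trans (F-approx j 0≤ε (proj₁ ∘ p n N≤n)) (ℚₚ.+-monoˡ-≤ (C · ε) le)))
        (≤+-weaken {q = F j′ k n} Cε≤e (F-approx j′ 0≤ε (proj₂ ∘ p n N≤n))))
    split : ∀ e ε N → 0ℚ ≤ ε → C · ε ≤ e → e + e ≤ η →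
      (∀ n → N ℕ.≤ n → ∀ u → Within ε (approximation k n u) (approximation k N u)) →
      Eventually (λ n → F j k n ≤ F j′ k n + η) ⊎ Eventually (λ n → F j′ k n ≤ F j k n + η)
    split e ε N 0≤ε Cε≤e e+e≤η p with ℚₚ.≤-total (F j k N) (F j′ k N)
    ... | inj₁ le = inj₁ (compare e ε N 0≤ε Cε≤e e+e≤η p j j′ le)
    ... | inj₂ le = inj₂ (compare e ε N 0≤ε Cε≤e e+e≤η p j′ j le)

  -- Grid points of mesh 1/(m+1)

  abstract
    gridCoord : ℕ → Vec ℕ d → Fin (suc d) → ℚ
    gridCoord m t j = stick (suc m) t j · unit m

    gridCoord-nonneg : ∀ m t j → 0ℚ ≤ gridCoord m t j
    gridCoord-nonneg m t j = ·-nonneg (stick (suc m) t j) (ℚₚ.<⇒≤ (unit-positive m))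

    gridCoord≤1 : ∀ m t j → gridCoord m t j ≤ 1ℚ
    gridCoord≤1 m t j = subst (gridCoord m t j ≤_) (suc·unit m)
      (·-monoˡ-≤ (ℚₚ.<⇒≤ (unit-positive m))
        (subst (stick (suc m) t j ℕ.≤_) (sum-stick (suc m) t) (term≤sumℕ (stick (suc m) t) j)))

    sum-gridCoord : ∀ m t → sum (gridCoord m t) ≡ 1ℚ
    sum-gridCoord m t = trans (sum-· (stick (suc m) t) (unit m))
      (trans (cong (_· unit m) (sum-stick (suc m) t)) (suc·unit m))

    -- By `stick-lipschitz` with equal initial sticks, each piece changes by at most d mesh units.
    near-coord : ∀ {m p t} → Near (suc m) p t → ∀ {e} → d · unit m ≤ e → ∀ j →
                 Within e (gridCoord m p j) (gridCoord m t j)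
    near-coord {m} {p} {t} near {e} small j =
      bound p t (λ i → ℕₚ.m≤n⇒m≤1+n (proj₁ (near i)) , proj₂ (near i)) ,
      bound t p (λ i → proj₂ (near i) , ℕₚ.m≤n⇒m≤1+n (proj₁ (near i)))
      where
      open ℚₚ.≤-Reasoning
      bound : ∀ s t → (∀ i → lookup s i ℕ.≤ suc (lookup t i) × lookup t i ℕ.≤ suc (lookup s i)) →
              gridCoord m s j ≤ gridCoord m t j + e
      bound s t close = begin
        gridCoord m s j                                ≤⟨ ·-monoˡ-≤ (ℚₚ.<⇒≤ (unit-positive m))
                                                            (stick-lipschitz 0 s t close (ℕₚ.m≤m+n (suc m) 0) j) ⟩
        (stick (suc m) t j ℕ.+ d) · unit m             ≡⟨ ×-homo-+ (unit m) (stick (suc m) t j) d ⟩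
        gridCoord m t j + d · unit m                   ≤⟨ ℚₚ.+-monoʳ-≤ (gridCoord m t j) small ⟩
        gridCoord m t j + e                            ∎

    vanishing-gridCoord : ∀ m t j → stick (suc m) t j ≡ 0 → gridCoord m t j ≡ 0ℚ
    vanishing-gridCoord m t j eq = cong (_· unit m) eq

  gridPoint : ℕ → Vec ℕ d → ∥ Δ ∥
  gridPoint m t = pointwise (λ j → const (gridCoord m t j))
    (λ j _ → gridCoord-nonneg m t j) (λ _ → sum-gridCoord m t)

  vanishing-gridPoint : ∀ m t j → stick (suc m) t j ≡ 0 → ¬ 0ℝ <ℝ coord (gridPoint m t) j
  vanishing-gridPoint m t j eq = ≤⇒≮ {const (gridCoord m t j)} {0ℝ} λ _ →
    ℚₚ.≤-reflexive (vanishing-gridCoord m t j eq)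

  G : Fin (suc d) → ℕ → Vec ℕ d → ℕ → ℚ
  G j m t = F j (h⁻¹ (gridPoint m t))

  -- Small cells with sign changes and their limit

  module _ {η} (0<η : 0ℚ < η) where

    -- The labels fed to `crossing-cell`, giving the approximate sign of F (suc i) - F zero. On the
    -- two sides `stick-low` and `stick-high` put the grid point on a facet, where `boundary`
    -- justifies the prescribed label.
    sign : ∀ m i t → ∃ λ b →
      (b ≡ false → Eventually λ n → G (suc i) m t n ≤ G zero m t n + η) ×
      (b ≡ true → Eventually λ n → G zero m t n ≤ G (suc i) m t n + η) ×
      (lookup t i ≡ 0 → b ≡ false) × (lookup t i ≡ suc m → b ≡ true)
    sign m i t = orient (lookup t i) (suc m) ℕₚ.0≢1+n
      (λ eq → boundary (gridPoint m t) (suc i)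
        (vanishing-gridPoint m t (suc i) (stick-low (suc m) t i eq)) zero 0<η)
      (λ eq → boundary (gridPoint m t) zero
        (vanishing-gridPoint m t zero (stick-high (suc m) t i (ℕₚ.≤-reflexive (sym eq)))) (suc i) 0<η)
      (dichotomy (h⁻¹ (gridPoint m t)) (suc i) zero 0<η)

    cell : ∀ m → ∃ λ p → ∀ i → ∃₂ λ t t′ →
      (Near (suc m) p t × Eventually λ n → G (suc i) m t n ≤ G zero m t n + η) ×
      (Near (suc m) p t′ × Eventually λ n → G zero m t′ n ≤ G (suc i) m t′ n + η)
    cell m =
      let p , cross = crossing-cell (suc m) (λ i t → proj₁ (sign m i t))
            (λ i t → proj₁ (proj₂ (proj₂ (proj₂ (sign m i t)))))
            (λ i t → proj₂ (proj₂ (proj₂ (proj₂ (sign m i t)))))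
      in p , λ i → let t , t′ , (near , low) , (near′ , high) = cross i in
           t , t′ , (near , proj₁ (proj₂ (sign m i t)) low) ,
           (near′ , proj₁ (proj₂ (proj₂ (sign m i t′))) high)

    corner : ℕ → Vec ℕ d
    corner m = proj₁ (cell m)

    accumulation : ∃ λ y → ∀ {e} → 0ℚ < e → ∀ M → ∃ λ m → M ℕ.≤ m ×
      Eventually λ n → ∀ j → Within e (seq (coord y j) n) (gridCoord m (corner m) j)
    accumulation = compactness {λ m → gridCoord m (corner m)}
      (λ m j → gridCoord-nonneg m (corner m) j) (λ m j → gridCoord≤1 m (corner m) j)
      (λ m → sum-gridCoord m (corner m))

    limit : ∥ Δ ∥
    limit = proj₁ accumulation

    -- The distance from the limit to the corner and from the corner to `t` is at most `e` each. The
    -- third `e` is the positive gap that `_<ℝ_` demands.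
    cluster : ∀ {g} → 0ℚ < g → ∃ λ m → ∀ t → Near (suc m) (corner m) t →
              ∃ λ e → 0ℚ < e × Eventually λ n → ∀ j →
              ∣ seq (coord limit j) n - gridCoord m t j ∣ + e ≤ g
    cluster {g} 0<g =
      let e , 0<e , 4e≤g = fraction 4 0<g
          q , 0<q , dq≤e = fraction d 0<e
          M , small = unit-vanishes 0<q
          m , M≤m , close = proj₂ accumulation 0<e M
          unit≤ = ℚₚ.≤-trans (·-monoʳ-≤ d (small m M≤m)) dq≤e
      in m , λ t near → e , 0<e , ev-map (λ p j →
           combine e 4e≤g 0<e (p j) (near-coord {p = corner m} {t} near unit≤ j)) close
      where
      open ℚₚ.≤-Reasoning
      combine : ∀ e → 4 · e ≤ g → 0ℚ < e → ∀ {p q r} → Within e p q → Within e q r → ∣ p - r ∣ + e ≤ g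
      combine e 4e≤g 0<e {p} {q} {r} (p≤ , q≤) (q≤′ , r≤) = begin
        ∣ p - r ∣ + e   ≤⟨ ℚₚ.+-monoˡ-≤ e (within⇒∣-∣≤ (≤+-trans {r = r} p≤ q≤′ , ≤+-trans {r = p} r≤ q≤)) ⟩
        e + e + e       ≤⟨ 4e≤η⇒3e≤η 0<e 4e≤g ⟩
        g               ∎

    continuity : ∀ {ε} → 0ℚ < ε → ∃ λ m → ∀ t → Near (suc m) (corner m) t →
      Eventually λ n → ∀ u → Within ε (approximation (h⁻¹ limit) n u) (approximation (h⁻¹ (gridPoint m t)) n u)
    continuity {ε} 0<ε =
      -- `seq δ` eventually exceeds `g`, so `g` serves as a rational radius in place of δ.
      let δ , mk< g N 0<g 0<δ , cont = Homeomorphism.from-continuous h limit (const ε) (0<const 0<ε)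
          m , close = cluster 0<g
      in m , λ t near →
           let e , 0<e , M , p = close t near in
           ev-∀ λ u → ∣-∣<ℝ⇒within {coord (h⁻¹ limit) u} {coord (h⁻¹ (gridPoint m t)) u}
             (cont (gridPoint m t) (λ j → mk< e (N ℕ.⊔ M) 0<e λ n le →
               ℚₚ.≤-<-trans (p n (ℕₚ.m⊔n≤o⇒n≤o N M le) j)
                 (subst (_< seq δ n) (ℚₚ.+-identityˡ g) (0<δ n (ℕₚ.m⊔n≤o⇒m≤o N M le)))) u)

  -- Passing from `a` to `b` and back costs `C · ε` each time; with the error `e` of the given
  -- inequality this makes at most three times `e`.
  transfer : ∀ {e ε η} → 0ℚ ≤ ε → C · ε ≤ e → 4 · e ≤ η → 0ℚ < e → ∀ j j′ {a b : Fin v → ℚ} →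
    (∀ u → Within ε (a u) (b u)) → weigh (A j) b ≤ weigh (A j′) b + e →
    weigh (A j) a ≤ weigh (A j′) a + η
  transfer {e} {ε} {η} 0≤ε Cε≤e 4e≤η 0<e j j′ {a} {b} close le = ≤+-weaken {q = weigh (A j′) a}
    (4e≤η⇒3e≤η 0<e 4e≤η)
    (≤+-trans {r = weigh (A j′) a}
      (≤+-weaken {q = weigh (A j) b} Cε≤e (F-approx j 0≤ε (proj₁ ∘ close)))
      (≤+-trans {r = weigh (A j′) a} le
        (≤+-weaken {q = weigh (A j′) a} Cε≤e (F-approx j′ 0≤ε (proj₂ ∘ close)))))

  -- For each i one cell near the limit has two vertices with opposite inequalities, and both pass
  -- to the limit by `transfer`. The labels depend on the tolerance, so every η gets its own point.
  balanced : ∀ {η} → 0ℚ < η → ∃ λ k → Eventually λ n → ∀ i → Within η (F (suc i) k n) (F zero k n)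
  balanced {η} 0<η =
    let e , ε , 0<ε , Cε≤e , 4e≤η , 0<e = tolerance 0<η
        m , close = continuity 0<e 0<ε
    in h⁻¹ (limit 0<e) , ev-∀ λ i →
      let t , t′ , (near , low) , (near′ , high) = proj₂ (cell 0<e m) i in
      ev-× (ev-zip (transfer (ℚₚ.<⇒≤ 0<ε) Cε≤e 4e≤η 0<e (suc i) zero) (close t near) low)
           (ev-zip (transfer (ℚₚ.<⇒≤ 0<ε) Cε≤e 4e≤η 0<e zero (suc i)) (close t′ near′) high)

  -- Rational weights that are exactly nonnegative and exactly supported on a face

  sum-approx : ∀ {a b : Fin v → ℚ} {ε} → (∀ u → a u ≤ b u + ε) → sum a ≤ sum b + v · ε
  sum-approx {a} {b} {ε} le = begin
    sum a                       ≤⟨ sum-mono le ⟩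
    sum (λ u → b u + ε)         ≡⟨ ∑-distrib-+ b (λ _ → ε) ⟩
    sum b + sum {v} (λ _ → ε)   ≡⟨ cong (sum b +_) (sum-replicate v) ⟩
    sum b + v · ε               ∎
    where open ℚₚ.≤-Reasoning

  -- Approximations of a coordinate may be negative, or nonzero off the support. The counting below
  -- multiplies inequalities by the weights, so these defects are removed at a cost of at most ε.
  truncate : ∥ K ∥ → ℕ → Fin v → ℚ
  truncate k n u = if does (u ∈? proj₁ (support k)) then approximation k n u ⊔ 0ℚ else 0ℚ

  truncate-nonneg : ∀ k n u → 0ℚ ≤ truncate k n u
  truncate-nonneg k n u with u ∈? proj₁ (support k)
  ... | yes _ = ℚₚ.p≤q⊔p (approximation k n u) 0ℚ
  ... | no  _ = ℚₚ.≤-refl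

  truncate-supported : ∀ k n u → u ∉ proj₁ (support k) → truncate k n u ≡ 0ℚ
  truncate-supported k n u u∉ with u ∈? proj₁ (support k)
  ... | yes u∈ = ⊥-elim (u∉ u∈)
  ... | no  _  = refl

  truncate-within : ∀ k n {ε} → 0ℚ ≤ ε →
    (∀ u → 0ℚ ≤ approximation k n u + ε) →
    (∀ u → u ∉ proj₁ (support k) → approximation k n u ≤ 0ℚ + ε) →
    ∀ u → Within ε (truncate k n u) (approximation k n u)
  truncate-within k n {ε} 0≤ε pos sup u with u ∈? proj₁ (support k)
  ... | yes _  = ℚₚ.⊔-lub (p≤p+q (approximation k n u) 0≤ε) (pos u) ,
                 ℚₚ.≤-trans (ℚₚ.p≤p⊔q (approximation k n u) 0ℚ) (p≤p+q _ 0≤ε)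
  ... | no  u∉ = pos u , sup u u∉

  balanced-weights : ∀ {η} → 0ℚ < η → ∃₂ λ (σ : Face K) (b : Fin v → ℚ) →
    (∀ u → 0ℚ ≤ b u) × (∀ u → u ∉ proj₁ σ → b u ≡ 0ℚ) × Within η (sum b) 1ℚ ×
    ∀ j → Within η (weigh (A j) b) (weigh (A zero) b)
  balanced-weights {η} 0<η =
    let e , 0<e , 4e≤η = fraction 4 0<η
        -- One ε controls both the loads, through `C`, and the sum of the coordinates, through `v`.
        ε , 0<ε , Cvε≤e = fraction (C ℕ.+ v) 0<e
        0≤ε = ℚₚ.<⇒≤ 0<ε
        Cε≤e = ℚₚ.≤-trans (·-monoˡ-≤ 0≤ε (ℕₚ.m≤m+n C v)) Cvε≤e
        vε≤e = ℚₚ.≤-trans (·-monoˡ-≤ 0≤ε (ℕₚ.m≤n+m v C)) Cvε≤e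
        k , bal = balanced 0<e
        N , p = ev-× bal (ev-× (≈⇒within (sum≈1 k) 0<e)
                  (ev-× (approximately-nonneg k 0<ε) (approximately-supported k 0<ε)))
        bal′ , unit′ , pos , sup = p N ℕₚ.≤-refl
        close = truncate-within k N 0≤ε pos sup
        weights = truncate k N
    in support k , weights , truncate-nonneg k N , truncate-supported k N ,
       total e 4e≤η 0<e {approximation k N} {weights}
         (≤+-weaken {q = sum (approximation k N)} vε≤e (sum-approx (proj₁ ∘ close)))
         (≤+-weaken {q = sum weights} vε≤e (sum-approx (proj₂ ∘ close)))
         (subst (λ z → Within e z 1ℚ) (seq-sumℝ (coord k) N) unit′) ,
       λ j → near-zero e ε 0≤ε Cε≤e 4e≤η 0<e {weights} {approximation k N} close bal′ j
    where
    near-zero : ∀ e ε → 0ℚ ≤ ε → C · ε ≤ e → 4 · e ≤ η → 0ℚ < e → ∀ {b a : Fin v → ℚ} →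
      (∀ u → Within ε (b u) (a u)) → (∀ i → Within e (weigh (A (suc i)) a) (weigh (A zero) a)) →
      ∀ j → Within η (weigh (A j) b) (weigh (A zero) b)
    near-zero e ε 0≤ε Cε≤e 4e≤η 0<e {b} close bal zero =
      p≤p+q (weigh (A zero) b) (ℚₚ.<⇒≤ 0<η) , p≤p+q (weigh (A zero) b) (ℚₚ.<⇒≤ 0<η)
    near-zero e ε 0≤ε Cε≤e 4e≤η 0<e close bal (suc i) =
      transfer 0≤ε Cε≤e 4e≤η 0<e (suc i) zero close (proj₁ (bal i)) ,
      transfer 0≤ε Cε≤e 4e≤η 0<e zero (suc i) close (proj₂ (bal i))
    total : ∀ e → 4 · e ≤ η → 0ℚ < e → ∀ {a b : Fin v → ℚ} → sum b ≤ sum a + e → sum a ≤ sum b + e →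
            Within e (sum a) 1ℚ → Within η (sum b) 1ℚ
    total e 4e≤η 0<e {a} {b} b≤ a≤ (≤1 , 1≤) =
      ≤+-weaken {q = 1ℚ} (4e≤η⇒2e≤η 0<e 4e≤η) (≤+-trans {r = 1ℚ} {y = e} b≤ ≤1) ,
      ≤+-weaken {q = sum b} (4e≤η⇒2e≤η 0<e 4e≤η) (≤+-trans {r = sum b} 1≤ a≤)

-- Counting colors

indicator : ∀ {n} → Subset n → Fin n → ℕ
indicator S j = if lookup S j then 1 else 0

sum-indicator : ∀ {n} (S : Subset n) → sumℕ (indicator S) ≡ card S
sum-indicator []          = refl
sum-indicator (true  ∷ S) = cong suc (sum-indicator S)
sum-indicator (false ∷ S) = sum-indicator S

∈⇒indicator≡1 : ∀ {n} {S : Subset n} {j} → j ∈ S → indicator S j ≡ 1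
∈⇒indicator≡1 j∈ = cong (if_then 1 else 0) (Vecₚ.[]=⇒lookup j∈)

·1-cancel-≤ : ∀ {m n ε} → ε < 1ℚ → m · 1ℚ ≤ n · 1ℚ + ε → m ℕ.≤ n
·1-cancel-≤ {m} {n} {ε} ε<1 le = ℕₚ.≮⇒≥ λ n<m → ℚₚ.<-irrefl refl (begin-strict
  m · 1ℚ        ≤⟨ le ⟩
  n · 1ℚ + ε    <⟨ ℚₚ.+-monoʳ-< (n · 1ℚ) ε<1 ⟩
  n · 1ℚ + 1ℚ   ≡⟨ ℚₚ.+-comm (n · 1ℚ) 1ℚ ⟩
  suc n · 1ℚ    ≤⟨ ·-monoˡ-≤ (ℚₚ.nonNegative⁻¹ 1ℚ) n<m ⟩
  m · 1ℚ        ∎)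
  where open ℚₚ.≤-Reasoning

weigh-mix : ∀ {n v} (χ : Fin n → ℕ) (A : Fin n → Fin v → ℕ) b →
            weigh χ (λ j → weigh (A j) b) ≡ weigh (λ u → sumℕ λ j → χ j ℕ.* A j u) b
weigh-mix χ A b = begin
  sum (λ j → χ j · sum (λ u → A j u · b u))           ≡⟨ sum-cong-≗ (λ j → ·-sum (χ j) (λ u → A j u · b u)) ⟩
  sum (λ j → sum (λ u → χ j · (A j u · b u)))
    ≡⟨ sum-cong-≗ (λ j → sum-cong-≗ λ u → ×-assocˡ (b u) (χ j) (A j u)) ⟩
  sum (λ j → sum (λ u → (χ j ℕ.* A j u) · b u))       ≡⟨ ∑-comm (λ j u → (χ j ℕ.* A j u) · b u) ⟩
  sum (λ u → sum (λ j → (χ j ℕ.* A j u) · b u))       ≡⟨ sum-cong-≗ (λ u → sum-· (λ j → χ j ℕ.* A j u) (b u)) ⟩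
  sum (λ u → sumℕ (λ j → χ j ℕ.* A j u) · b u)        ∎
  where
  open ≡-Reasoning
  ·-sum : ∀ m {k} (a : Fin k → ℚ) → m · sum a ≡ sum (λ u → m · a u)
  ·-sum m {zero}  a = ·-zeroʳ m
  ·-sum m {suc k} a = trans (×-distrib-+ (a zero) (sum (a ∘ suc)) m)
                            (cong (m · a zero +_) (·-sum m (a ∘ suc)))

module _ {n v} (A : Fin n → Fin v → ℕ) {T} (columns : ∀ u → sumℕ (λ j → A j u) ≡ T)
         {b : Fin v → ℚ} {x η} (0≤b : ∀ u → 0ℚ ≤ b u) (0≤η : 0ℚ ≤ η)
         (b≈1 : Within η (sum b) 1ℚ) (loads : ∀ j → Within η (weigh (A j) b) x) where

  private
    open ℚₚ.≤-Reasoning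

    weigh-const : ∀ {k} m (a : Fin k → ℚ) → weigh (λ _ → m) a ≡ m · sum a
    weigh-const {zero}  m a = sym (·-zeroʳ m)
    weigh-const {suc k} m a = trans (cong (m · a zero +_) (weigh-const m (a ∘ suc)))
                                    (sym (×-distrib-+ (a zero) (sum (a ∘ suc)) m))

    ·-≤+ : ∀ m {p q ε} → p ≤ q + ε → m · p ≤ m · q + m · ε
    ·-≤+ m {p} {q} {ε} le = ℚₚ.≤-trans (·-monoʳ-≤ m le) (ℚₚ.≤-reflexive (×-distrib-+ q ε m))

    sumℕ-1 : ∀ k → sumℕ {k} (λ _ → 1) ≡ k
    sumℕ-1 zero    = refl
    sumℕ-1 (suc k) = cong suc (sumℕ-1 k)

    total-load : weigh {n} (λ _ → 1) (λ j → weigh (A j) b) ≡ T · sum b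
    total-load = trans (weigh-mix (λ _ → 1) A b)
      (trans (sum-cong-≗ λ u → cong (_· b u) (trans (ℕ-Sum.sum-cong-≗ λ j → ℕₚ.*-identityˡ (A j u)) (columns u)))
             (weigh-const T b))

    -- The n loads, each close to `x`, add up to T times the sum of `b`, which is close to T.
    average : n · x ≤ T · 1ℚ + (T ℕ.+ n) · η
    average = begin
      n · x                                     ≡⟨ cong (_· x) (sumℕ-1 n) ⟨
      sumℕ {n} (λ _ → 1) · x                    ≡⟨ sum-· {n} (λ _ → 1) x ⟨
      weigh {n} (λ _ → 1) (λ _ → x)
        ≤⟨ weigh-approx {n} (λ _ → 1) {b = λ j → weigh (A j) b} 0≤η (ℕₚ.≤-reflexive (sumℕ-1 n)) (proj₂ ∘ loads) ⟩
      weigh {n} (λ _ → 1) (λ j → weigh (A j) b) + n · η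
                                                ≡⟨ cong (_+ n · η) total-load ⟩
      T · sum b + n · η                         ≤⟨ ℚₚ.+-monoˡ-≤ (n · η) (·-≤+ T (proj₁ b≈1)) ⟩
      T · 1ℚ + T · η + n · η                    ≡⟨ ℚₚ.+-assoc (T · 1ℚ) (T · η) (n · η) ⟩
      T · 1ℚ + (T · η + n · η)                  ≡⟨ cong (T · 1ℚ +_) (×-homo-+ η T n) ⟨
      T · 1ℚ + (T ℕ.+ n) · η                    ∎

  -- Up to errors, t is at most the sum of the loads in `S`, that is s x with s = `card S`.
  -- Multiplying by n replaces n x by T and avoids a division; `small` keeps the total error below
  -- one, so the inequality holds between integers.
  demand≤supply : ∀ (S : Subset n) t →
    (∀ u → b u ≡ 0ℚ ⊎ t ℕ.≤ sumℕ λ j → indicator S j ℕ.* A j u) →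
    (n ℕ.* (card S ℕ.+ t) ℕ.+ card S ℕ.* (T ℕ.+ n)) · η < 1ℚ →
    n ℕ.* t ℕ.≤ card S ℕ.* T
  demand≤supply S t demand small = ·1-cancel-≤ small (begin
    (n ℕ.* t) · 1ℚ                              ≡⟨ ×-assocˡ 1ℚ n t ⟨
    n · (t · 1ℚ)                                ≤⟨ ·-≤+ n served ⟩
    n · (s · x) + n · ((s ℕ.+ t) · η)
      ≡⟨ cong₂ _+_ (trans (×-assocˡ x n s) (cong (_· x) (ℕₚ.*-comm n s))) (×-assocˡ η n (s ℕ.+ t)) ⟩
    (s ℕ.* n) · x + (n ℕ.* (s ℕ.+ t)) · η       ≡⟨ cong (_+ (n ℕ.* (s ℕ.+ t)) · η) (×-assocˡ x s n) ⟨
    s · (n · x) + (n ℕ.* (s ℕ.+ t)) · η         ≤⟨ ≤+-trans {r = (s ℕ.* T) · 1ℚ} ℚₚ.≤-refl bound ⟩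
    (s ℕ.* T) · 1ℚ + ((s ℕ.* (T ℕ.+ n)) · η + (n ℕ.* (s ℕ.+ t)) · η)
      ≡⟨ cong ((s ℕ.* T) · 1ℚ +_) (trans
           (ℚₚ.+-comm ((s ℕ.* (T ℕ.+ n)) · η) ((n ℕ.* (s ℕ.+ t)) · η))
           (sym (×-homo-+ η (n ℕ.* (s ℕ.+ t)) (s ℕ.* (T ℕ.+ n))))) ⟩
    (s ℕ.* T) · 1ℚ + (n ℕ.* (s ℕ.+ t) ℕ.+ s ℕ.* (T ℕ.+ n)) · η ∎)
    where
    s = card S
    χ = indicator S
    bound : s · (n · x) ≤ (s ℕ.* T) · 1ℚ + (s ℕ.* (T ℕ.+ n)) · η
    bound = ℚₚ.≤-trans (·-≤+ s average)
      (ℚₚ.≤-reflexive (cong₂ _+_ (×-assocˡ 1ℚ s T) (×-assocˡ η s (T ℕ.+ n))))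
    termwise : ∀ u → t · b u ≤ sumℕ (λ j → χ j ℕ.* A j u) · b u
    termwise u with demand u
    ... | inj₁ eq = ℚₚ.≤-reflexive (trans (cong (t ·_) eq) (trans (·-zeroʳ t)
                      (sym (trans (cong (sumℕ (λ j → χ j ℕ.* A j u) ·_) eq) (·-zeroʳ (sumℕ λ j → χ j ℕ.* A j u))))))
    ... | inj₂ le = ·-monoˡ-≤ (0≤b u) le
    covered : t · sum b ≤ s · x + s · η
    covered = begin
      t · sum b                                 ≡⟨ weigh-const t b ⟨
      weigh (λ _ → t) b                         ≤⟨ sum-mono termwise ⟩
      weigh (λ u → sumℕ λ j → χ j ℕ.* A j u) b  ≡⟨ weigh-mix χ A b ⟨
      weigh χ (λ j → weigh (A j) b)
        ≤⟨ weigh-approx χ {b = λ _ → x} 0≤η (ℕₚ.≤-reflexive (sum-indicator S)) (proj₁ ∘ loads) ⟩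
      weigh χ (λ _ → x) + s · η                 ≡⟨ cong (_+ s · η) (trans (sum-· χ x) (cong (_· x) (sum-indicator S))) ⟩
      s · x + s · η                             ∎
    served : t · 1ℚ ≤ s · x + (s ℕ.+ t) · η
    served = subst (λ z → t · 1ℚ ≤ s · x + z) (sym (×-homo-+ η s t))
      (≤+-trans {r = s · x} {y = s · η} (·-≤+ t (proj₂ b≈1)) covered)

-- The load matrix of a family of colorings

pick : ∀ {n} (χ : Fin n → ℕ) k w → sumℕ (λ j → χ j ℕ.* (if does (k Finₚ.≟ j) then w else 0)) ≡ χ k ℕ.* w
pick χ zero w = trans (cong (χ zero ℕ.* w ℕ.+_) (zeros (χ ∘ suc))) (ℕₚ.+-identityʳ _)
  where
  zeros : ∀ {n} (χ : Fin n → ℕ) → sumℕ (λ j → χ j ℕ.* 0) ≡ 0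
  zeros {zero}  χ = refl
  zeros {suc n} χ = trans (cong (ℕ._+ sumℕ (λ j → χ (suc j) ℕ.* 0)) (ℕₚ.*-zeroʳ (χ zero))) (zeros (χ ∘ suc))
pick χ (suc k) w = trans
  (cong (ℕ._+ sumℕ (λ j → χ (suc j) ℕ.* (if does (k Finₚ.≟ j) then w else 0))) (ℕₚ.*-zeroʳ (χ zero)))
  (pick (χ ∘ suc) k w)

load : ∀ {n v l} → (Fin l → ℕ) → (Fin l → Fin v → Fin n) → Fin n → Fin v → ℕ
load W c j u = sumℕ λ i → if does (c i u Finₚ.≟ j) then W i else 0

-- After exchanging the sums, i contributes only at j = c i u. Constant χ gives the column sums, an
-- indicator χ the weight of those colors of u that lie in a set.
sum-load : ∀ {n v l} (W : Fin l → ℕ) (c : Fin l → Fin v → Fin n) (χ : Fin n → ℕ) u →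
           sumℕ (λ j → χ j ℕ.* load W c j u) ≡ sumℕ (λ i → χ (c i u) ℕ.* W i)
sum-load W c χ u = begin
  sumℕ (λ j → χ j ℕ.* load W c j u)
    ≡⟨ ℕ-Sum.sum-cong-≗ (λ j → ℕ-Sum.*-distribˡ-sum (χ j) (λ i → if does (c i u Finₚ.≟ j) then W i else 0)) ⟩
  sumℕ (λ j → sumℕ (λ i → χ j ℕ.* (if does (c i u Finₚ.≟ j) then W i else 0)))
    ≡⟨ ℕ-Sum.∑-comm (λ j i → χ j ℕ.* (if does (c i u Finₚ.≟ j) then W i else 0)) ⟩
  sumℕ (λ i → sumℕ (λ j → χ j ℕ.* (if does (c i u Finₚ.≟ j) then W i else 0)))
    ≡⟨ ℕ-Sum.sum-cong-≗ (λ i → pick χ (c i u) (W i)) ⟩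
  sumℕ (λ i → χ (c i u) ℕ.* W i) ∎
  where open ≡-Reasoning

∈-⋃ : ∀ {n l} (S : Fin l → Subset n) {j} i → j ∈ S i → j ∈ ⋃ (List.tabulate S)
∈-⋃ S zero    j∈ = x∈p∪q⁺ (inj₁ j∈)
∈-⋃ S (suc i) j∈ = x∈p∪q⁺ (inj₂ (∈-⋃ (S ∘ suc) i j∈))

-- The choice of weights and the conclusion

theorem2p1 : ExcludedMiddle 0ℓ →
    ∀ {n v : ℕ} (K : SimplicialComplex v)
    (f : SMap K (fullSimplex n)) → IsSubdivision f →
    ∀ {l : ℕ} → ℕ.NonZero l →
    (c : Fin l → SMap K (fullSimplex n)) → (∀ i → IsSpernerColoring f (c i)) →
    (m : Fin l → ℕ) → ℤ.+ sumℕ m ≡ ℤ.+ n ℤ.- ℤ.+ 1 →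
    ∃ λ (σ : Face K) →
    (∀ i → m i ℕ.< card (image (c i) σ)) ×
    ⋃ (List.tabulate (λ i → image (c i) σ)) ≡ ⊤
-- For empty N the sum of the `m i` would be -1.
theorem2p1 em {zero}  K f subdivision l≢0 c sperner m ()
theorem2p1 em {suc d} {v} K f (h , h-support) {l} l≢0 c sperner m sum-m =
  -- `bound` dominates the error coefficient of `demand≤supply` for all `R` and all t ≤ `T`, so the
  -- error is at most one half.
  let η , 0<η , bη≤½ = fraction bound {½} (*<* (ℤ.+<+ (ℕ.s≤s ℕ.z≤n)))
      σ , b , 0≤b , b-supported , b≈1 , balanced = balanced-weights 0<η
      S = λ i → image (c i) σ
      color : ∀ i {u} → u ∈ proj₁ σ → vertex i u ∈ S i
      color i {u} u∈ = Equivalence.from (proj₂ (proj₁ (sperner i)) σ (vertex i u)) (u , u∈ , refl)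
      count : ∀ R t → t ℕ.≤ T → (∀ u → u ∈ proj₁ σ → t ℕ.≤ sumℕ λ j → indicator R j ℕ.* A j u) →
              t ℕ.≤ card R ℕ.* l
      count = λ R t t≤T demand → cancel R t (demand≤supply A columns 0≤b (ℚₚ.<⇒≤ 0<η) b≈1 balanced R t
        (λ u → split σ u (b-supported u) (demand u))
        (ℚₚ.≤-<-trans (ℚₚ.≤-trans (·-monoˡ-≤ (ℚₚ.<⇒≤ 0<η) (bounded R t≤T)) bη≤½) (*<* (ℤ.+<+ (ℕ.s≤s (ℕ.s≤s ℕ.z≤n))))))
  in σ ,
     -- `W i` is the successor of `m i * l`, so the bound from `count` is already a strict
     -- inequality.
     (λ i → ℕₚ.*-cancelʳ-< l (m i) (card (S i))
       (count (S i) (W i) (subst (W i ℕ.≤_) sum-W (term≤sumℕ W i)) λ u u∈ →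
         subst (W i ℕ.≤_) (sym (sum-load W vertex (indicator (S i)) u))
           (ℕₚ.≤-trans
             (ℕₚ.≤-reflexive (sym (trans (cong (ℕ._* W i) (∈⇒indicator≡1 (color i u∈))) (ℕₚ.*-identityˡ (W i)))))
             (term≤sumℕ (λ i′ → indicator (S i) (vertex i′ u) ℕ.* W i′) i)))) ,
     -- All colors of a vertex of σ lie in the union, so its demand there is the whole of `T`.
     full (⋃ (List.tabulate S)) (count (⋃ (List.tabulate S)) T ℕₚ.≤-refl λ u u∈ →
       ℕₚ.≤-reflexive (trans (sym sum-W) (sym (trans (sum-load W vertex (indicator (⋃ (List.tabulate S))) u)
         (ℕ-Sum.sum-cong-≗ λ i → trans (cong (ℕ._* W i) (∈⇒indicator≡1 (∈-⋃ S i (color i u∈)))) (ℕₚ.*-identityˡ (W i)))))))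
  where
  n = suc d
  instance
    l-nonZero : ℕ.NonZero l
    l-nonZero = l≢0
  T : ℕ
  T = n ℕ.* l
  W : Fin l → ℕ
  W i = suc (m i ℕ.* l)
  vertex : Fin l → Fin v → Fin n
  vertex i = proj₁ (proj₁ (sperner i))
  A : Fin n → Fin v → ℕ
  A = load W vertex
  -- The added ones contribute l and the `m i` contribute d * l, together `suc d` times l.
  sum-W : sumℕ W ≡ T
  sum-W = begin
    sumℕ W                      ≡⟨ sum-suc (λ i → m i ℕ.* l) ⟩
    l ℕ.+ sumℕ (λ i → m i ℕ.* l) ≡⟨ cong (l ℕ.+_) (ℕ-Sum.*-distribʳ-sum l m) ⟨
    l ℕ.+ sumℕ m ℕ.* l          ≡⟨ cong (λ s → l ℕ.+ s ℕ.* l) (ℤₚ.+-injective sum-m) ⟩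
    T                           ∎
    where
    open ≡-Reasoning
    sum-suc : ∀ {k} (g : Fin k → ℕ) → sumℕ (λ i → suc (g i)) ≡ k ℕ.+ sumℕ g
    sum-suc {zero}  g = refl
    sum-suc {suc k} g = cong suc (trans (cong (g zero ℕ.+_) (sum-suc (g ∘ suc)))
      (trans (sym (ℕₚ.+-assoc (g zero) k (sumℕ (g ∘ suc))))
        (trans (cong (ℕ._+ sumℕ (g ∘ suc)) (ℕₚ.+-comm (g zero) k)) (ℕₚ.+-assoc k (g zero) (sumℕ (g ∘ suc))))))
  columns : ∀ u → sumℕ (λ j → A j u) ≡ T
  columns u = begin
    sumℕ (λ j → A j u)            ≡⟨ ℕ-Sum.sum-cong-≗ (λ j → ℕₚ.*-identityˡ (A j u)) ⟨
    sumℕ (λ j → 1 ℕ.* A j u)      ≡⟨ sum-load W vertex (λ _ → 1) u ⟩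
    sumℕ (λ i → 1 ℕ.* W i)        ≡⟨ ℕ-Sum.sum-cong-≗ (λ i → ℕₚ.*-identityˡ (W i)) ⟩
    sumℕ W                        ≡⟨ sum-W ⟩
    T                             ∎
    where open ≡-Reasoning
  -- The Sperner condition enters here: a color of a vertex of σ lies in c i (σ), hence in f (σ).
  carried : ∀ (σ : Face K) j u → u ∈ proj₁ σ → j ∉ image f σ → A j u ≡ 0
  carried σ j u u∈ j∉ = trans (ℕ-Sum.sum-cong-≗ zero-term) (ℕ-Sum.sum-replicate-zero l)
    where
    zero-term : ∀ i → (if does (vertex i u Finₚ.≟ j) then W i else 0) ≡ 0
    zero-term i with vertex i u Finₚ.≟ j
    ... | no  _    = refl
    ... | yes refl = ⊥-elim (j∉ (proj₂ (sperner i) σ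
      (Equivalence.from (proj₂ (proj₁ (sperner i)) σ (vertex i u)) (u , u∈ , refl))))
  open Balance em K f h h-support A carried
  bound : ℕ
  bound = n ℕ.* (n ℕ.+ T) ℕ.+ n ℕ.* (T ℕ.+ n)
  bounded : ∀ (R : Subset n) {t} → t ℕ.≤ T →
            n ℕ.* (card R ℕ.+ t) ℕ.+ card R ℕ.* (T ℕ.+ n) ℕ.≤ bound
  bounded R t≤T = ℕₚ.+-mono-≤ (ℕₚ.*-monoʳ-≤ n (ℕₚ.+-mono-≤ (∣p∣≤n R) t≤T))
                              (ℕₚ.*-monoˡ-≤ (T ℕ.+ n) (∣p∣≤n R))
  cancel : ∀ (R : Subset n) t → n ℕ.* t ℕ.≤ card R ℕ.* T → t ℕ.≤ card R ℕ.* l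
  cancel R t le = ℕₚ.*-cancelˡ-≤ n (ℕₚ.≤-trans le (ℕₚ.≤-reflexive (begin
    card R ℕ.* (n ℕ.* l)   ≡⟨ ℕₚ.*-assoc (card R) n l ⟨
    card R ℕ.* n ℕ.* l     ≡⟨ cong (ℕ._* l) (ℕₚ.*-comm (card R) n) ⟩
    n ℕ.* card R ℕ.* l     ≡⟨ ℕₚ.*-assoc n (card R) l ⟩
    n ℕ.* (card R ℕ.* l)   ∎)))
    where open ≡-Reasoning
  full : ∀ (R : Subset n) → T ℕ.≤ card R ℕ.* l → R ≡ ⊤
  full R le = ∣p∣≡n⇒p≡⊤ (ℕₚ.≤-antisym (∣p∣≤n R) (ℕₚ.*-cancelʳ-≤ n (card R) l le))
  split : ∀ (σ : Face K) u {P Q : Set} → (u ∉ proj₁ σ → P) → (u ∈ proj₁ σ → Q) → P ⊎ Q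
  split σ u off on with u ∈? proj₁ σ
  ... | yes u∈ = inj₂ (on u∈)
  ... | no  u∉ = inj₁ (off u∉)
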